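{- Let $n,k$ be positive integers and let $X=\{x_1,\ldots,x_n\}\subset\mathbb{R}$ be a set of $n$ real numbers (indexed, possibly with repeated values) whose sum is zero, with $x_i\ge x_j$ whenever $i\le j$. If $n\ge 8k^2$, then at least $\binom{n-1}{k-1}$ $k$-element subsets of $X$ have nonnegative sum. Moreover, if equality holds (i.e. exactly $\binom{n-1}{k-1}$ $k$-element subsets of $X$ have nonnegative sum), then the family of $k$-element subsets of $X$ with nonnegative sum is the star on $x_1$, namely $\left\{S\in\binom{X}{k} : x_1\in S\right\}$.
   Context: The numbers $x_1,\ldots,x_n$ are regarded as $n$ distinct labelled elements, even if some values coincide; thus $k$-element subsets of $X$ correspond to $k$-element subsets of the index set $\{1,\ldots,n\}$, and the sum of a subset is the sum of the corresponding $x_i$. $\binom{X}{k}$ denotes the family of all $k$-element subsets of $X$; "$x_1\in S$" means that the index $1$ belongs to the index set of $S$. -}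

module Defs where

open import Algebra.Bundles.Raw using (RawMonoid)
import Algebra.Definitions.RawMonoid as RawMonoidSum
open import Data.Bool.Base using (if_then_else_)
open import Data.Fin.Base using (Fin; fromℕ<)
open import Data.Fin.Subset using (Subset; inside; outside; ∣_∣; _∈_)
open import Data.List.Base using (List; []; _∷_; map; length; _++_)
import Data.List.Membership.Propositional as List
open import Data.List.Membership.Propositional.Properties
  using (∈-map⁺; ∈-map⁻; ∈-++⁺ˡ; ∈-++⁺ʳ; ∈-++⁻)
open import Data.List.Relation.Unary.All using ([])
open import Data.List.Relation.Unary.Any using (here)
open import Data.List.Relation.Unary.AllPairs using ([]; _∷_)
open import Data.List.Relation.Unary.Unique.Propositional using (Unique)
import Data.List.Relation.Unary.Unique.Propositional.Properties as Unique
open import Data.Nat.Base as ℕ using (ℕ; zero; suc; NonZero; >-nonZero⁻¹)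
import Data.Nat.Properties as ℕ
open import Data.Product.Base using (∃; ∃-syntax; _×_; _,_)
open import Data.Rational.Base using (ℚ; 0ℚ; ½; _+_; _-_; _*_; _<_; _≤_)
  renaming (∣_∣ to ∣_∣ℚ)
open import Data.Rational.Properties
  using (∣p+q∣≤∣p∣+∣q∣; +-mono-<; *-monoʳ-<-pos; *-zeroʳ; *-identityˡ;
         *-distribʳ-+; module ≤-Reasoning)
open import Data.Rational.Solver using (module +-*-Solver)
open import Data.Sum.Base using (inj₁; inj₂)
open import Data.Vec.Base using ([]; _∷_; lookup)
open import Data.Vec.Functional using (Vector)
open import Data.Vec.Properties using (∷-injectiveʳ)
open import Function.Base using (_∘_)
open import Function.Bundles using (_⇔_; mk⇔; module Equivalence)
open import Level using (0ℓ)
open import Relation.Binary.PropositionalEquality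
  using (_≡_; refl; sym; trans; cong; subst)
open import Relation.Nullary using (¬_; yes; no; contradiction)
open import Relation.Nullary.Decidable using (¬¬-excluded-middle)
open import Relation.Unary using (Pred)

-- ℝ is the Cauchy completion of ℚ, presented as a setoid: a real is a
-- rational Cauchy sequence, and equality of reals is _≃ℝ_, not _≡_.

Eventually : Pred ℕ 0ℓ → Set
Eventually P = ∃[ N ] ∀ n → N ℕ.≤ n → P n

IsCauchy : (ℕ → ℚ) → Set
IsCauchy s = ∀ ε → 0ℚ < ε →
  ∃[ N ] ∀ m n → N ℕ.≤ m → N ℕ.≤ n → ∣ s m - s n ∣ℚ < ε

record ℝ : Set where
  constructor mkℝ
  field
    seq    : ℕ → ℚ
    cauchy : IsCauchy seq

open ℝ public

infix  4 _≃ℝ_ _≤ℝ_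
infixl 6 _+ℝ_

_≃ℝ_ : ℝ → ℝ → Set
x ≃ℝ y = ∀ ε → 0ℚ < ε → Eventually λ n → ∣ seq x n - seq y n ∣ℚ < ε

_≤ℝ_ : ℝ → ℝ → Set
x ≤ℝ y = ∀ ε → 0ℚ < ε → Eventually λ n → seq x n ≤ seq y n + ε

0ℝ : ℝ
0ℝ = mkℝ (λ _ → 0ℚ) λ ε 0<ε → 0 , λ _ _ _ _ → 0<ε

private
  half-pos : ∀ {ε} → 0ℚ < ε → 0ℚ < ½ * ε
  half-pos {ε} 0<ε = subst (_< ½ * ε) (*-zeroʳ ½) (*-monoʳ-<-pos ½ 0<ε)

  half+half : ∀ ε → ½ * ε + ½ * ε ≡ ε
  half+half ε = trans (sym (*-distribʳ-+ ε ½ ½)) (*-identityˡ ε)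

  regroup : ∀ a b c d → (a + b) - (c + d) ≡ (a - c) + (b - d)
  regroup = solve 4 (λ a b c d → (a :+ b) :- (c :+ d) := (a :- c) :+ (b :- d)) refl
    where open +-*-Solver

_+ℝ_ : ℝ → ℝ → ℝ
x +ℝ y = mkℝ (λ n → seq x n + seq y n) isCauchy
  where
  isCauchy : IsCauchy (λ n → seq x n + seq y n)
  isCauchy ε 0<ε with cauchy x (½ * ε) (half-pos 0<ε) | cauchy y (½ * ε) (half-pos 0<ε)
  ... | M , x-close | N , y-close = M ℕ.⊔ N , λ m n M⊔N≤m M⊔N≤n →
    let open ≤-Reasoning
        a = seq x m ; b = seq y m ; c = seq x n ; d = seq y n
    in begin-strict
      ∣ (a + b) - (c + d) ∣ℚ      ≡⟨ cong ∣_∣ℚ (regroup a b c d) ⟩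
      ∣ (a - c) + (b - d) ∣ℚ      ≤⟨ ∣p+q∣≤∣p∣+∣q∣ (a - c) (b - d) ⟩
      ∣ a - c ∣ℚ + ∣ b - d ∣ℚ
        <⟨ +-mono-< (x-close m n (ℕ.m⊔n≤o⇒m≤o M N M⊔N≤m) (ℕ.m⊔n≤o⇒m≤o M N M⊔N≤n))
                    (y-close m n (ℕ.m⊔n≤o⇒n≤o M N M⊔N≤m) (ℕ.m⊔n≤o⇒n≤o M N M⊔N≤n)) ⟩
      ½ * ε + ½ * ε               ≡⟨ half+half ε ⟩
      ε                           ∎

+ℝ-rawMonoid : RawMonoid 0ℓ 0ℓ
+ℝ-rawMonoid = record { Carrier = ℝ ; _≈_ = _≃ℝ_ ; _∙_ = _+ℝ_ ; ε = 0ℝ }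

open RawMonoidSum +ℝ-rawMonoid public using () renaming (sum to sumℝ)

sumOver : ∀ {n} → Vector ℝ n → Subset n → ℝ
sumOver x S = sumℝ λ i → if lookup S i then x i else 0ℝ

NonnegativeSubset : ∀ {n} → ℕ → Vector ℝ n → Pred (Subset n) 0ℓ
NonnegativeSubset k x S = ∣ S ∣ ≡ k × 0ℝ ≤ℝ sumOver x S

firstIndex : ∀ n .{{_ : NonZero n}} → Fin n
firstIndex n = fromℕ< (>-nonZero⁻¹ n)

Star : ∀ {n} → ℕ → Fin n → Pred (Subset n) 0ℓ
Star k i S = ∣ S ∣ ≡ k × i ∈ S

HasCardinality : ∀ {a p} {A : Set a} → Pred A p → ℕ → Set _
HasCardinality {A = A} P c =
  ∃[ xs ] Unique xs × (∀ (a : A) → a List.∈ xs ⇔ P a) × length xs ≡ c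

-- Since _≤ℝ_ is not decidable, a family of subsets need not have a
-- cardinality that can be computed.  Classically it always has one, so a
-- statement about every c with HasCardinality P c is not vacuous:

¬¬-hasCardinality : ∀ {n} (P : Pred (Subset n) 0ℓ) → ¬ ¬ (∃ (HasCardinality P))
¬¬-hasCardinality {zero} P k = ¬¬-excluded-middle λ where
  (yes p) → k (1 , [] ∷ [] , [] ∷ [] ,
                (λ { [] → mk⇔ (λ _ → p) (λ _ → here refl) }) , refl)
  (no ¬p) → k (0 , [] , [] ,
                (λ { [] → mk⇔ (λ ()) (λ p → contradiction p ¬p) }) , refl)
¬¬-hasCardinality {suc n} P k =
  ¬¬-hasCardinality (P ∘ (inside ∷_)) λ { (_ , xs , xs! , xs⇔ , _) →
  ¬¬-hasCardinality (P ∘ (outside ∷_)) λ { (_ , ys , ys! , ys⇔ , _) →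
  k (_ , map (inside ∷_) xs ++ map (outside ∷_) ys ,
     Unique.++⁺ (Unique.map⁺ ∷-injectiveʳ xs!) (Unique.map⁺ ∷-injectiveʳ ys!)
                (λ { (p , q) → disjoint p q }) ,
     (λ S → mk⇔ (to xs⇔ ys⇔ S) (from xs⇔ ys⇔ S)) , refl) } }
  where
  disjoint : ∀ {xs ys} {S : Subset (suc n)} →
    S List.∈ map (inside ∷_) xs → ¬ (S List.∈ map (outside ∷_) ys)
  disjoint p q with ∈-map⁻ (inside ∷_) p | ∈-map⁻ (outside ∷_) q
  ... | _ , _ , refl | _ , _ , ()

  module _ {xs ys : List (Subset n)}
           (xs⇔ : ∀ S → S List.∈ xs ⇔ P (inside ∷ S))
           (ys⇔ : ∀ S → S List.∈ ys ⇔ P (outside ∷ S)) where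

    to : ∀ S → S List.∈ map (inside ∷_) xs ++ map (outside ∷_) ys → P S
    to S p with ∈-++⁻ (map (inside ∷_) xs) p
    ... | inj₁ q with ∈-map⁻ (inside ∷_) q
    ...   | S′ , r , refl = Equivalence.to (xs⇔ S′) r
    to S p | inj₂ q with ∈-map⁻ (outside ∷_) q
    ...   | S′ , r , refl = Equivalence.to (ys⇔ S′) r

    from : ∀ S → P S → S List.∈ map (inside ∷_) xs ++ map (outside ∷_) ys
    from (inside  ∷ S) p = ∈-++⁺ˡ (∈-map⁺ (inside ∷_) (Equivalence.from (xs⇔ S) p))
    from (outside ∷ S) p = ∈-++⁺ʳ (map (inside ∷_) xs)
                                  (∈-map⁺ (outside ∷_) (Equivalence.from (ys⇔ S) p))

{-# OPTIONS --safe #-}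
module Submission where

-- Let N count the k-subsets with nonnegative sum, let a = x₁ and let b count
-- the members T ∪ {1} of the star with a + x(T) < 0.  For such a T the sets
-- T ∪ {y} have total at most −(n − k)a over all y, so averaging shows that
-- the negative k-sums are large in total.  The sum of all k-sums is 0 and each
-- k-sum is at most ka, so N k² ≥ (n − k − 1) b: either the star is almost
-- entirely nonnegative or there are far more nonnegative sets than needed.
-- If the star contains a negative set S, the elements outside S have positive
-- sum, and the same dichotomy applied to them gives a constant proportion of
-- C(n−1, k−1) further nonnegative sets, all outside the star.
--
-- The real case reduces to the integers: real sequences are replaced by terms
-- far enough out that every negative k-sum stays negative.  Finding such terms
-- is not constructive, but the conclusion is ¬¬-stable, because the given
-- enumeration of the family makes membership in it decidable.

open import Defs
open import Algebra.Bundles.Raw using (RawMonoid)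
import Algebra.Definitions.RawMonoid as RawMonoidSum
import Algebra.Properties.CommutativeSemigroup as CommutativeSemigroup
open import Data.Bool.Base using (true; false; if_then_else_)
import Data.Bool.Properties as Bool
open import Data.Empty using (⊥)
open import Data.Fin.Base as Fin using (Fin)
open import Data.Fin.Subset as Subset using (Subset; inside; outside; ∣_∣)
import Data.Fin.Subset.Properties as Subset
open import Data.Integer.Base as ℤ
  using (ℤ; +_; -[1+_]; 0ℤ; 1ℤ; -1ℤ; +≤+; -≤+; -≤-; +<+; nonNegative; positive; Positive)
import Data.Integer.Properties as ℤ
import Data.Integer.Tactic.RingSolver as ℤ-Solver
open import Data.List.Base using (List; []; _∷_; length; foldr; _++_; map; filter; tabulate)
import Data.List.Membership.DecPropositional as DecMembership
import Data.List.Membership.Propositional as List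
open import Data.List.Membership.Propositional.Properties
  using (∈-∃++; ∈-++⁻; ∈-++⁺ˡ; ∈-++⁺ʳ; ∈-map⁻; ∈-filter⁻)
open import Data.List.Properties using (length-++; length-map; map-++; map-∘; map-cong; length-tabulate)
open import Data.List.Relation.Binary.Permutation.Propositional
  using (_↭_; refl; prep; swap; trans; ↭-sym)
open import Data.List.Relation.Binary.Permutation.Propositional.Properties
  using (All-resp-↭; ↭-length; shift)
open import Data.List.Relation.Unary.All as All using (All; []; _∷_)
import Data.List.Relation.Unary.All.Properties as All
open import Data.List.Relation.Unary.AllPairs using ([]; _∷_)
open import Data.List.Relation.Unary.Any using (here; there)
open import Data.List.Relation.Unary.Unique.Propositional using (Unique)
import Data.List.Relation.Unary.Unique.Propositional.Properties as Unique
open import Data.Nat.Base as ℕ using (ℕ; zero; suc; s≤s; z≤n)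
open import Data.Nat.Combinatorics using (_C_; nC1≡n; nCk+nC[k+1]≡[n+1]C[k+1]; k>n⇒nCk≡0)
import Data.Nat.Properties as ℕ
import Data.Nat.Tactic.RingSolver as ℕ-Solver
open import Data.Product.Base using (∃-syntax; ∃₂; _×_; _,_; proj₁; proj₂)
open import Data.Rational.Base as ℚ using (ℚ; 0ℚ; ½; toℚᵘ)
import Data.Rational.Properties as ℚ
open import Data.Rational.Solver using (module +-*-Solver)
open import Data.Rational.Unnormalised.Base as ℚᵘ using (mkℚᵘ; *≡*; *≤*)
import Data.Rational.Unnormalised.Properties as ℚᵘ
open import Data.Sum.Base using (_⊎_; inj₁; inj₂; [_,_]′)
open import Data.Vec.Base using ([]; _∷_; lookup; here)
open import Data.Vec.Functional using (Vector)
open import Data.Vec.Properties using (∷-injectiveʳ; ≡-dec)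
open import Function.Base using (_∘_)
open import Function.Bundles using (module Equivalence)
open import Level using (0ℓ)
open import Relation.Binary.PropositionalEquality as ≡
  using (_≡_; cong; cong₂; sym; subst; subst₂)
open import Relation.Nullary using (¬_; Dec; yes; no; contradiction)
open import Relation.Nullary.Decidable using (decidable-stable; _×-dec_)
open import Relation.Unary using (_≐_)

open CommutativeSemigroup ℤ.+-commutativeSemigroup using (interchange; x∙yz≈y∙xz)
private module ℕ+ = CommutativeSemigroup ℕ.+-commutativeSemigroup

-- Sums over the k-element sublists of a list of integers.

module _ where

  open import Data.Integer.Base using (_+_; _-_; -_; _*_; _≤_; _<_)

  private
    variable
      f g : ℤ → ℤ
      F G : ℤ → ℤ → ℤ
      a : ℤ

  Σℤ : List ℤ → ℤ
  Σℤ = foldr _+_ 0ℤ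

  -- Sublists are chosen by position, so equal entries count as distinct. Only the total of a
  -- sublist reaches `f`, so taking an entry amounts to shifting `f`.
  ∑C : ℕ → (ℤ → ℤ) → List ℤ → ℤ
  ∑C zero    f _       = f 0ℤ
  ∑C (suc k) f []      = 0ℤ
  ∑C (suc k) f (y ∷ Y) = ∑C k (λ s → f (y + s)) Y + ∑C (suc k) f Y

  ∑C-cong : ∀ k Y → (∀ s → f s ≡ g s) → ∑C k f Y ≡ ∑C k g Y
  ∑C-cong zero    Y       f≗g = f≗g 0ℤ
  ∑C-cong (suc k) []      f≗g = ≡.refl
  ∑C-cong (suc k) (y ∷ Y) f≗g = cong₂ _+_ (∑C-cong k Y λ s → f≗g (y + s)) (∑C-cong (suc k) Y f≗g)

  ∑C-+ : ∀ f g k Y → ∑C k (λ s → f s + g s) Y ≡ ∑C k f Y + ∑C k g Y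
  ∑C-+ f g zero    Y       = ≡.refl
  ∑C-+ f g (suc k) []      = ≡.refl
  ∑C-+ f g (suc k) (y ∷ Y) = ≡.trans
    (cong₂ _+_ (∑C-+ f′ g′ k Y) (∑C-+ f g (suc k) Y))
    (interchange (∑C k f′ Y) (∑C k g′ Y) (∑C (suc k) f Y) (∑C (suc k) g Y))
    where
    f′ = λ s → f (y + s)
    g′ = λ s → g (y + s)

  ∑C-*ˡ : ∀ c f k Y → ∑C k (λ s → c * f s) Y ≡ c * ∑C k f Y
  ∑C-*ˡ c f zero    Y       = ≡.refl
  ∑C-*ˡ c f (suc k) []      = sym (ℤ.*-zeroʳ c)
  ∑C-*ˡ c f (suc k) (y ∷ Y) = ≡.trans
    (cong₂ _+_ (∑C-*ˡ c f′ k Y) (∑C-*ˡ c f (suc k) Y))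
    (sym (ℤ.*-distribˡ-+ c (∑C k f′ Y) (∑C (suc k) f Y)))
    where
    f′ = λ s → f (y + s)

  +-suc* : ∀ k {y s a} → y ≤ a → s ≤ + k * a → y + s ≤ + suc k * a
  +-suc* k {y} {s} {a} y≤a s≤ka = subst (y + s ≤_) (sym (ℤ.suc-* (+ k) a)) (ℤ.+-mono-≤ y≤a s≤ka)

  -- `f` and `g` are compared only up to k a, since k entries that are each at most `a` cannot total
  -- more.
  ∑C-mono : ∀ k {Y} → All (_≤ a) Y → (∀ s → s ≤ + k * a → f s ≤ g s) → ∑C k f Y ≤ ∑C k g Y
  ∑C-mono zero    _          f≤g = f≤g 0ℤ (+≤+ ℕ.z≤n)
  ∑C-mono (suc k) []         f≤g = +≤+ ℕ.z≤n
  ∑C-mono (suc k) (y≤a ∷ Y≤) f≤g =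
    ℤ.+-mono-≤ (∑C-mono k Y≤ λ s s≤ka → f≤g _ (+-suc* k y≤a s≤ka)) (∑C-mono (suc k) Y≤ f≤g)

  ∑C-0 : ∀ k Y → ∑C k (λ _ → 0ℤ) Y ≡ 0ℤ
  ∑C-0 zero    Y       = ≡.refl
  ∑C-0 (suc k) []      = ≡.refl
  ∑C-0 (suc k) (y ∷ Y) = cong₂ _+_ (∑C-0 k Y) (∑C-0 (suc k) Y)

  ∑C-1 : ∀ k Y → ∑C k (λ _ → 1ℤ) Y ≡ + (length Y C k)
  ∑C-1 zero    Y       = ≡.refl
  ∑C-1 (suc k) []      = cong +_ (sym (k>n⇒nCk≡0 {0} {suc k} (ℕ.s≤s ℕ.z≤n)))
  ∑C-1 (suc k) (y ∷ Y) =
    ≡.trans (cong₂ _+_ (∑C-1 k Y) (∑C-1 (suc k) Y)) (cong +_ (nCk+nC[k+1]≡[n+1]C[k+1] (length Y) k))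

  -- Double counting of pairs of a k-set and an element outside it.

  -- The sum of F (ΣT) b over all k-element T and all b outside T.
  ∑P : ℕ → (ℤ → ℤ → ℤ) → List ℤ → ℤ
  ∑P k       F []      = 0ℤ
  ∑P zero    F (y ∷ Y) = F 0ℤ y + ∑P zero F Y
  ∑P (suc k) F (y ∷ Y) = ∑C (suc k) (λ s → F s y) Y + (∑P k (λ s → F (y + s)) Y + ∑P (suc k) F Y)

  ∑P-cong : ∀ k Y → (∀ s b → F s b ≡ G s b) → ∑P k F Y ≡ ∑P k G Y
  ∑P-cong k       []      F≗G = ≡.refl
  ∑P-cong zero    (y ∷ Y) F≗G = cong₂ _+_ (F≗G 0ℤ y) (∑P-cong zero Y F≗G)
  ∑P-cong (suc k) (y ∷ Y) F≗G = cong₂ _+_ (∑C-cong (suc k) Y λ s → F≗G s y)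
    (cong₂ _+_ (∑P-cong k Y λ s → F≗G (y + s)) (∑P-cong (suc k) Y F≗G))

  ∑P-+ : ∀ F G k Y → ∑P k (λ s b → F s b + G s b) Y ≡ ∑P k F Y + ∑P k G Y
  ∑P-+ F G k       []      = ≡.refl
  ∑P-+ F G zero    (y ∷ Y) = ≡.trans (cong (_+_ (F 0ℤ y + G 0ℤ y)) (∑P-+ F G zero Y))
    (interchange (F 0ℤ y) (G 0ℤ y) (∑P zero F Y) (∑P zero G Y))
  ∑P-+ F G (suc k) (y ∷ Y) = ≡.trans
    (cong₂ _+_ (∑C-+ (λ s → F s y) (λ s → G s y) (suc k) Y)
      (≡.trans (cong₂ _+_ (∑P-+ F′ G′ k Y) (∑P-+ F G (suc k) Y))
             (interchange (∑P k F′ Y) (∑P k G′ Y) (∑P (suc k) F Y) (∑P (suc k) G Y))))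
    (interchange (∑C (suc k) (λ s → F s y) Y) (∑C (suc k) (λ s → G s y) Y)
                 (∑P k F′ Y + ∑P (suc k) F Y) (∑P k G′ Y + ∑P (suc k) G Y))
    where
    F′ = λ s → F (y + s)
    G′ = λ s → G (y + s)

  ∑P-mono : ∀ k {Y} → All (_≤ a) Y → (∀ s b → s ≤ + k * a → b ≤ a → F s b ≤ G s b) → ∑P k F Y ≤ ∑P k G Y
  ∑P-mono k       []         F≤G = +≤+ ℕ.z≤n
  ∑P-mono zero    (y≤a ∷ Y≤) F≤G =
    ℤ.+-mono-≤ (F≤G 0ℤ _ (+≤+ ℕ.z≤n) y≤a) (∑P-mono zero Y≤ F≤G)
  ∑P-mono (suc k) (y≤a ∷ Y≤) F≤G = ℤ.+-mono-≤
    (∑C-mono (suc k) Y≤ λ s s≤ → F≤G s _ s≤ y≤a)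
    (ℤ.+-mono-≤ (∑P-mono k Y≤ λ s b s≤ → F≤G _ b (+-suc* k y≤a s≤)) (∑P-mono (suc k) Y≤ F≤G))

  -- Each (k + 1)-set arises from exactly k + 1 pairs, one for each choice of its element `b`.
  ∑P-merge : ∀ f k Y → ∑P k (λ s b → f (s + b)) Y ≡ + suc k * ∑C (suc k) f Y
  ∑P-merge f k [] = sym (ℤ.*-zeroʳ (+ suc k))
  ∑P-merge f zero (y ∷ Y) = begin
    f (0ℤ + y) + ∑P 0 (λ s b → f (s + b)) Y  ≡⟨ cong₂ _+_ (cong f (ℤ.+-comm 0ℤ y)) (∑P-merge f 0 Y) ⟩
    f (y + 0ℤ) + 1ℤ * ∑C 1 f Y               ≡⟨ lemma (f (y + 0ℤ)) (∑C 1 f Y) ⟩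
    1ℤ * (f (y + 0ℤ) + ∑C 1 f Y)             ∎
    where
    open ≡.≡-Reasoning
    lemma : ∀ p q → p + 1ℤ * q ≡ 1ℤ * (p + q)
    lemma = ℤ-Solver.solve-∀
  ∑P-merge f (suc k) (y ∷ Y) = begin
    ∑C (suc k) (λ s → f (s + y)) Y + (∑P k (λ s b → f ((y + s) + b)) Y + ∑P (suc k) (λ s b → f (s + b)) Y)
      ≡⟨ cong₂ _+_ (∑C-cong (suc k) Y λ s → cong f (ℤ.+-comm s y))
           (cong₂ _+_ (≡.trans (∑P-cong k Y λ s b → cong f (ℤ.+-assoc y s b)) (∑P-merge (λ s → f (y + s)) k Y))
                      (∑P-merge f (suc k) Y)) ⟩
    ∑C (suc k) (λ s → f (y + s)) Y + (+ suc k * ∑C (suc k) (λ s → f (y + s)) Y + (1ℤ + + suc k) * ∑C (suc (suc k)) f Y)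
      ≡⟨ lemma (+ suc k) (∑C (suc k) (λ s → f (y + s)) Y) (∑C (suc (suc k)) f Y) ⟩
    (1ℤ + + suc k) * (∑C (suc k) (λ s → f (y + s)) Y + ∑C (suc (suc k)) f Y) ∎
    where
    open ≡.≡-Reasoning
    lemma : ∀ κ p q → p + (κ * p + (1ℤ + κ) * q) ≡ (1ℤ + κ) * (p + q)
    lemma = ℤ-Solver.solve-∀

  -- Each T has `length Y` - k elements outside it; the k elements inside are added back on the
  -- left.
  ∑P-left : ∀ f k Y → ∑P k (λ s _ → f s) Y + + k * ∑C k f Y ≡ + length Y * ∑C k f Y
  ∑P-left f zero    []      = ≡.refl
  ∑P-left f (suc k) []      = ≡.trans (ℤ.+-identityˡ _) (ℤ.*-zeroʳ (+ suc k))
  ∑P-left f zero (y ∷ Y) = begin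
    (c + p) + 0ℤ * c         ≡⟨ ℤ.+-assoc c p (0ℤ * c) ⟩
    c + (p + 0ℤ * c)         ≡⟨ cong (_+_ c) (∑P-left f zero Y) ⟩
    c + + length Y * c       ≡⟨ ℤ.suc-* (+ length Y) c ⟨
    + suc (length Y) * c     ∎
    where
    open ≡.≡-Reasoning
    c = f 0ℤ
    p = ∑P zero (λ s _ → f s) Y
  ∑P-left f (suc k) (y ∷ Y) = begin
    (c₁ + (p₀ + p₁)) + (1ℤ + + k) * (c₀ + c₁)                ≡⟨ split (+ k) c₀ c₁ p₀ p₁ ⟩
    (c₀ + c₁) + ((p₀ + + k * c₀) + (p₁ + (1ℤ + + k) * c₁))   ≡⟨ cong (_+_ (c₀ + c₁)) (cong₂ _+_ (∑P-left (λ s → f (y + s)) k Y) (∑P-left f (suc k) Y)) ⟩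
    (c₀ + c₁) + (+ length Y * c₀ + + length Y * c₁)          ≡⟨ join (+ length Y) c₀ c₁ ⟩
    (1ℤ + + length Y) * (c₀ + c₁)                            ∎
    where
    open ≡.≡-Reasoning
    c₀ = ∑C k (λ s → f (y + s)) Y
    c₁ = ∑C (suc k) f Y
    p₀ = ∑P k (λ s _ → f (y + s)) Y
    p₁ = ∑P (suc k) (λ s _ → f s) Y
    split : ∀ k c₀ c₁ p₀ p₁ → (c₁ + (p₀ + p₁)) + (1ℤ + k) * (c₀ + c₁) ≡
            (c₀ + c₁) + ((p₀ + k * c₀) + (p₁ + (1ℤ + k) * c₁))
    split = ℤ-Solver.solve-∀
    join : ∀ m c₀ c₁ → (c₀ + c₁) + (m * c₀ + m * c₁) ≡ (1ℤ + m) * (c₀ + c₁)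
    join = ℤ-Solver.solve-∀

  -- The elements outside T total `Σℤ Y` minus the total of T; the second sum adds the latter back.
  ∑P-right : ∀ f k Y → ∑P k (λ s b → f s * b) Y + ∑C k (λ s → f s * s) Y ≡ Σℤ Y * ∑C k f Y
  ∑P-right f zero [] = ≡.trans (ℤ.+-identityˡ _) (ℤ.*-zeroʳ (f 0ℤ))
  ∑P-right f (suc k) []  = ≡.refl
  ∑P-right f zero (y ∷ Y) = begin
    (c * y + p) + c * 0ℤ      ≡⟨ ℤ.+-assoc (c * y) p _ ⟩
    c * y + (p + c * 0ℤ)      ≡⟨ cong (_+_ (c * y)) (∑P-right f zero Y) ⟩
    c * y + Σℤ Y * c          ≡⟨ lemma c y (Σℤ Y) ⟩
    (y + Σℤ Y) * c            ∎
    where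
    open ≡.≡-Reasoning
    c = f 0ℤ
    p = ∑P zero (λ s b → f s * b) Y
    lemma : ∀ c y σ → c * y + σ * c ≡ (y + σ) * c
    lemma = ℤ-Solver.solve-∀
  ∑P-right f (suc k) (y ∷ Y) = begin
    (∑C (suc k) (λ s → f s * y) Y + (p₀ + p₁)) + (∑C k (λ s → f (y + s) * (y + s)) Y + q₁)
      ≡⟨ cong₂ (λ x z → (x + (p₀ + p₁)) + (z + q₁))
           (≡.trans (∑C-cong (suc k) Y λ s → ℤ.*-comm (f s) y) (∑C-*ˡ y f (suc k) Y))
           (≡.trans (∑C-cong k Y λ s → distrib (f (y + s)) y s)
             (≡.trans (∑C-+ (λ s → y * f (y + s)) (λ s → f (y + s) * s) k Y)
               (cong (_+ q₀) (∑C-*ˡ y (λ s → f (y + s)) k Y)))) ⟩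
    (y * c₁ + (p₀ + p₁)) + ((y * c₀ + q₀) + q₁)
      ≡⟨ split y c₀ c₁ p₀ p₁ q₀ q₁ ⟩
    y * (c₀ + c₁) + ((p₀ + q₀) + (p₁ + q₁))
      ≡⟨ cong (_+_ (y * (c₀ + c₁))) (cong₂ _+_ (∑P-right (λ s → f (y + s)) k Y) (∑P-right f (suc k) Y)) ⟩
    y * (c₀ + c₁) + (Σℤ Y * c₀ + Σℤ Y * c₁)
      ≡⟨ join y (Σℤ Y) c₀ c₁ ⟩
    (y + Σℤ Y) * (c₀ + c₁) ∎
    where
    open ≡.≡-Reasoning
    c₀ = ∑C k (λ s → f (y + s)) Y
    c₁ = ∑C (suc k) f Y
    p₀ = ∑P k (λ s b → f (y + s) * b) Y
    p₁ = ∑P (suc k) (λ s b → f s * b) Y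
    q₀ = ∑C k (λ s → f (y + s) * s) Y
    q₁ = ∑C (suc k) (λ s → f s * s) Y
    distrib : ∀ p y s → p * (y + s) ≡ y * p + p * s
    distrib = ℤ-Solver.solve-∀
    split : ∀ y c₀ c₁ p₀ p₁ q₀ q₁ → (y * c₁ + (p₀ + p₁)) + ((y * c₀ + q₀) + q₁) ≡
            y * (c₀ + c₁) + ((p₀ + q₀) + (p₁ + q₁))
    split = ℤ-Solver.solve-∀
    join : ∀ y σ c₀ c₁ → y * (c₀ + c₁) + (σ * c₀ + σ * c₁) ≡ (y + σ) * (c₀ + c₁)
    join = ℤ-Solver.solve-∀

  -- Induction on k, splitting each (k + 1)-sum as T plus `b`. The share of T vanishes by induction.
  -- The share of `b` is the total of `Y` times a count, minus the sum of the k-sums, so it vanishes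
  -- too.
  ∑C-id : ∀ k Y → Σℤ Y ≡ 0ℤ → ∑C k (λ s → s) Y ≡ 0ℤ
  ∑C-id zero    Y ΣY≡0 = ≡.refl
  ∑C-id (suc k) Y ΣY≡0 = ℤ.*-cancelˡ-≡ (+ suc k) _ 0ℤ (begin
    + suc k * ∑C (suc k) (λ s → s) Y                    ≡⟨ ∑P-merge (λ s → s) k Y ⟨
    ∑P k (λ s b → s + b) Y                              ≡⟨ ∑P-+ (λ s _ → s) (λ _ b → b) k Y ⟩
    l + r                                               ≡⟨ cong₂ _+_ l≡0 r≡0 ⟩
    0ℤ                                                  ≡⟨ ℤ.*-zeroʳ (+ suc k) ⟨
    + suc k * 0ℤ                                        ∎)
    where
    open ≡.≡-Reasoning
    l = ∑P k (λ s _ → s) Y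
    r = ∑P k (λ _ b → b) Y
    IH = ∑C-id k Y ΣY≡0
    l≡0 : l ≡ 0ℤ
    l≡0 = begin
      l                               ≡⟨ ℤ.+-identityʳ l ⟨
      l + 0ℤ                          ≡⟨ cong (_+_ l) (ℤ.*-zeroʳ (+ k)) ⟨
      l + + k * 0ℤ                    ≡⟨ cong (λ c → l + + k * c) IH ⟨
      l + + k * ∑C k (λ s → s) Y      ≡⟨ ∑P-left (λ s → s) k Y ⟩
      + length Y * ∑C k (λ s → s) Y   ≡⟨ cong (+ length Y *_) IH ⟩
      + length Y * 0ℤ                 ≡⟨ ℤ.*-zeroʳ (+ length Y) ⟩
      0ℤ                              ∎
    r≡0 : r ≡ 0ℤ
    r≡0 = begin
      r                                                          ≡⟨ ℤ.+-identityʳ r ⟨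
      r + 0ℤ                                                     ≡⟨ cong₂ _+_ (∑P-cong k Y λ _ b → ℤ.*-identityˡ b) (≡.trans (∑C-cong k Y λ s → ℤ.*-identityˡ s) IH) ⟨
      ∑P k (λ _ b → 1ℤ * b) Y + ∑C k (λ s → 1ℤ * s) Y            ≡⟨ ∑P-right (λ _ → 1ℤ) k Y ⟩
      Σℤ Y * ∑C k (λ _ → 1ℤ) Y                                   ≡⟨ cong (_* ∑C k (λ _ → 1ℤ) Y) ΣY≡0 ⟩
      0ℤ                                                         ∎

  -- Signs of these sums and the indicator of nonnegativity.

  0≤+ : ∀ {i j} → 0ℤ ≤ i → 0ℤ ≤ j → 0ℤ ≤ i + j
  0≤+ = ℤ.+-mono-≤

  0≤* : ∀ {i j} → 0ℤ ≤ i → 0ℤ ≤ j → 0ℤ ≤ i * j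
  0≤* {i} {j} 0≤i 0≤j =
    subst (_≤ i * j) (ℤ.*-zeroʳ i) (ℤ.*-monoˡ-≤-nonNeg i {{nonNegative 0≤i}} 0≤j)

  0≤+m : ∀ {m} → 0ℤ ≤ + m
  0≤+m = +≤+ ℕ.z≤n

  ∑C-nonneg : ∀ k {Y} → All (_≤ a) Y → (∀ s → s ≤ + k * a → 0ℤ ≤ f s) → 0ℤ ≤ ∑C k f Y
  ∑C-nonneg {f = f} k {Y} Y≤ 0≤f = subst (_≤ ∑C k f Y) (∑C-0 k Y) (∑C-mono k Y≤ 0≤f)

  ∑P-0 : ∀ k Y → ∑P k (λ _ _ → 0ℤ) Y ≡ 0ℤ
  ∑P-0 k       []      = ≡.refl
  ∑P-0 zero    (y ∷ Y) = cong (_+_ 0ℤ) (∑P-0 zero Y)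
  ∑P-0 (suc k) (y ∷ Y) = cong₂ _+_ (∑C-0 (suc k) Y) (cong₂ _+_ (∑P-0 k Y) (∑P-0 (suc k) Y))

  ∑P-nonneg : ∀ k {Y} → All (_≤ a) Y → (∀ s b → s ≤ + k * a → b ≤ a → 0ℤ ≤ F s b) → 0ℤ ≤ ∑P k F Y
  ∑P-nonneg {F = F} k {Y} Y≤ 0≤F = subst (_≤ ∑P k F Y) (∑P-0 k Y) (∑P-mono k Y≤ 0≤F)

  Σℤ≤ : ∀ {Y} → All (_≤ a) Y → Σℤ Y ≤ + length Y * a
  Σℤ≤ [] = +≤+ ℕ.z≤n
  Σℤ≤ {Y = _ ∷ Y} (y≤a ∷ Y≤) = +-suc* (length Y) y≤a (Σℤ≤ Y≤)

  -- A maximum is at least the average, which is 0.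
  max-nonneg : ∀ {Y} → All (_≤ a) Y → a + Σℤ Y ≡ 0ℤ → 0ℤ ≤ a
  max-nonneg {a} {Y} Y≤ sum≡0 = ℤ.*-cancelˡ-≤-pos 0ℤ a (+ suc (length Y))
    (subst₂ _≤_ (≡.trans sum≡0 (sym (ℤ.*-zeroʳ (+ suc (length Y))))) ≡.refl
      (+-suc* (length Y) ℤ.≤-refl (Σℤ≤ Y≤)))

  -- The indicator of nonnegativity, so `∑C k ν` counts the k-sets with nonnegative total.
  ν : ℤ → ℤ
  ν (+ _)    = 1ℤ
  ν -[1+ _ ] = 0ℤ

  0≤ν : ∀ s → 0ℤ ≤ ν s
  0≤ν (+ _)    = +≤+ ℕ.z≤n
  0≤ν -[1+ _ ] = +≤+ ℕ.z≤n

  -- Averaging over a list with total zero and maximum `a`.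

  module Dichotomy {a Y} (Y≤ : All (_≤ a) Y) (sum≡0 : a + Σℤ Y ≡ 0ℤ)
                   (j u : ℕ) (|Y|≡ : length Y ≡ suc j ℕ.+ u) where

    -- h dominates the negative part of every (j + 1)-sum, and β marks the j-sums
    -- whose star member is negative.
    κ = + suc j
    c = κ * a
    β h : ℤ → ℤ
    β s = 1ℤ + -1ℤ * ν (a + s)
    h s = c * ν s + -1ℤ * s

    -- With n = `length Y` + 1 and k = j + 1, `u` is n - k - 1, `N` is the N of the overview and
    -- `B⁻` its b. `L + R` adds up the totals of T ∪ {y} over the T whose star member is negative
    -- and the y in `Y` outside T.
    N = ∑C (suc j) ν (a ∷ Y)
    H = ∑C (suc j) h Y
    L = ∑P j (λ s _ → β s * s) Y
    R = ∑P j (λ s b → β s * b) Y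
    Q = ∑C j (λ s → β s * s) Y
    B⁻ = ∑C j β Y

    0≤a : 0ℤ ≤ a
    0≤a = max-nonneg Y≤ sum≡0

    0≤c : 0ℤ ≤ c
    0≤c = 0≤* {κ} 0≤+m 0≤a

    -- For s ≥ 0 this is the bound `c` on k-sums; for s < 0, `h s` is -s.
    0≤h : ∀ s → s ≤ c → 0ℤ ≤ h s
    0≤h s@(+ _) s≤c = subst (0ℤ ≤_) (lemma c s) (ℤ.i≤j⇒0≤j-i s≤c)
      where
      lemma : ∀ c s → c - s ≡ c * 1ℤ + -1ℤ * s
      lemma = ℤ-Solver.solve-∀
    0≤h -[1+ _ ] s≤c = 0≤+ (0≤* 0≤c 0≤+m) 0≤+m

    0≤β : ∀ s → 0ℤ ≤ β s
    0≤β s with a + s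
    ... | + _      = 0≤+m
    ... | -[1+ _ ] = 0≤+m

    0≤N : 0ℤ ≤ N
    0≤N = ∑C-nonneg (suc j) (ℤ.≤-refl ∷ Y≤) λ s _ → 0≤ν s

    0≤B⁻ : 0ℤ ≤ B⁻
    0≤B⁻ = ∑C-nonneg j Y≤ λ s _ → 0≤β s

    -- The k-sums of `a ∷ Y` add up to 0, so `h` adds up to c N over them; the sets containing `a`
    -- contribute a nonnegative amount and are dropped.
    H≤cN : H ≤ c * N
    H≤cN = begin
      H                                                             ≡⟨ ℤ.+-identityˡ H ⟨
      0ℤ + H                                                        ≤⟨ ℤ.+-monoˡ-≤ H (∑C-nonneg j Y≤ λ s s≤ja → 0≤h (a + s) (+-suc* j ℤ.≤-refl s≤ja)) ⟩
      ∑C (suc j) h (a ∷ Y)                                          ≡⟨ ∑C-+ (λ s → c * ν s) (λ s → -1ℤ * s) (suc j) (a ∷ Y) ⟩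
      ∑C (suc j) (λ s → c * ν s) (a ∷ Y) + ∑C (suc j) (λ s → -1ℤ * s) (a ∷ Y)
        ≡⟨ cong₂ _+_ (∑C-*ˡ c ν (suc j) (a ∷ Y))
             (≡.trans (∑C-*ˡ -1ℤ (λ s → s) (suc j) (a ∷ Y)) (cong (_*_ -1ℤ) (∑C-id (suc j) (a ∷ Y) sum≡0))) ⟩
      c * N + 0ℤ                                                    ≡⟨ ℤ.+-identityʳ (c * N) ⟩
      c * N                                                         ∎
      where open ℤ.≤-Reasoning

    -- The inequality holds for each pair. If the star member of T is nonnegative, only `h` remains;
    -- otherwise adding the total of T ∪ {b} to `h` leaves c times an indicator.
    0≤κH+L+R : 0ℤ ≤ κ * H + (L + R)
    0≤κH+L+R = subst (0ℤ ≤_) total (∑P-nonneg j Y≤ pointwise)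
      where
      total : ∑P j (λ s b → h (s + b) + (β s * s + β s * b)) Y ≡ κ * H + (L + R)
      total = ≡.trans
        (∑P-+ (λ s b → h (s + b)) (λ s b → β s * s + β s * b) j Y)
        (cong₂ _+_ (∑P-merge h j Y) (∑P-+ (λ s _ → β s * s) (λ s b → β s * b) j Y))
      pointwise : ∀ s b → s ≤ + j * a → b ≤ a → 0ℤ ≤ h (s + b) + (β s * s + β s * b)
      pointwise s b s≤ b≤ with a + s
      ... | + _      = 0≤+ (0≤h (s + b) (subst (_≤ c) (ℤ.+-comm b s) (+-suc* j b≤ s≤))) ℤ.≤-refl
      ... | -[1+ _ ] = subst (0ℤ ≤_) (lemma (c * ν (s + b)) s b) (0≤* 0≤c (0≤ν (s + b)))
        where
        lemma : ∀ p s b → p ≡ (p + -1ℤ * (s + b)) + (1ℤ * s + 1ℤ * b)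
        lemma = ℤ-Solver.solve-∀

    add-sub : ∀ l p → l ≡ (l + p) - p
    add-sub = ℤ-Solver.solve-∀

    L≡ : L ≡ (1ℤ + + u) * Q
    L≡ = begin
      L                                   ≡⟨ add-sub L (+ j * Q) ⟩
      (L + + j * Q) - + j * Q             ≡⟨ cong (_- + j * Q) (∑P-left (λ s → β s * s) j Y) ⟩
      + length Y * Q - + j * Q            ≡⟨ cong (λ m → + m * Q - + j * Q) |Y|≡ ⟩
      (1ℤ + (+ j + + u)) * Q - + j * Q    ≡⟨ lemma (+ j) (+ u) Q ⟩
      (1ℤ + + u) * Q                      ∎
      where
      open ≡.≡-Reasoning
      lemma : ∀ j u q → (1ℤ + (j + u)) * q - j * q ≡ (1ℤ + u) * q
      lemma = ℤ-Solver.solve-∀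

    R≡ : R ≡ - a * B⁻ - Q
    R≡ = begin
      R                 ≡⟨ add-sub R Q ⟩
      (R + Q) - Q       ≡⟨ cong (_- Q) (∑P-right β j Y) ⟩
      Σℤ Y * B⁻ - Q     ≡⟨ cong (λ σ → σ * B⁻ - Q) ΣY≡-a ⟩
      - a * B⁻ - Q      ∎
      where
      open ≡.≡-Reasoning
      cancel : ∀ a σ → σ ≡ (a + σ) + (- a)
      cancel = ℤ-Solver.solve-∀
      ΣY≡-a : Σℤ Y ≡ - a
      ΣY≡-a = ≡.trans (cancel a (Σℤ Y)) (≡.trans (cong (_+ - a) sum≡0) (ℤ.+-identityˡ (- a)))

    -- Integrality gives a + s ≤ -1, not just a + s < 0; this keeps the final
    -- cancellation of 1 + a valid when a = 0.
    0≤-Q-[1+a]B⁻ : 0ℤ ≤ -1ℤ * Q + (-1ℤ * (1ℤ + a)) * B⁻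
    0≤-Q-[1+a]B⁻ = subst (0ℤ ≤_) total (∑C-nonneg j Y≤ λ s _ → pointwise s)
      where
      d = -1ℤ * (1ℤ + a)
      total : ∑C j (λ s → -1ℤ * (β s * s) + d * β s) Y ≡ -1ℤ * Q + d * B⁻
      total = ≡.trans (∑C-+ (λ s → -1ℤ * (β s * s)) (λ s → d * β s) j Y)
        (cong₂ _+_ (∑C-*ˡ -1ℤ (λ s → β s * s) j Y) (∑C-*ˡ d β j Y))
      pointwise : ∀ s → 0ℤ ≤ -1ℤ * (β s * s) + d * β s
      pointwise s with a + s in eq
      ... | + _      = 0≤+ {0ℤ} {d * 0ℤ} ℤ.≤-refl (ℤ.≤-reflexive (sym (ℤ.*-zeroʳ d)))
      ... | -[1+ n ] = subst (0ℤ ≤_) (lemma a s) (subst (λ t → 0ℤ ≤ -1ℤ * (1ℤ + t)) (sym eq) (0≤-1*[-n] n))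
        where
        lemma : ∀ a s → -1ℤ * (1ℤ + (a + s)) ≡ -1ℤ * (1ℤ * s) + -1ℤ * (1ℤ + a) * 1ℤ
        lemma = ℤ-Solver.solve-∀
        0≤-1*[-n] : ∀ n → 0ℤ ≤ -1ℤ * (1ℤ + -[1+ n ])
        0≤-1*[-n] zero    = 0≤+m
        0≤-1*[-n] (suc n) = 0≤+m

    -- By `L≡` and `R≡`, κ H is at least a B⁻ - u Q, hence at least u (1 + a) B⁻, while κ H is at
    -- most κ² a N. Weakening the factor a on the right to 1 + a gives a common factor that is
    -- positive and cancels.
    dichotomy : + u * B⁻ ≤ (κ * κ) * N
    dichotomy = ℤ.*-cancelʳ-≤-pos (+ u * B⁻) ((κ * κ) * N) (1ℤ + a) {{1+a>0}}
      (ℤ.0≤i-j⇒j≤i (subst (0ℤ ≤_)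
        (≡.trans (cong (λ lr → ((κ * κ) * N + κ * (c * N - H)) + ((κ * H + lr) + (a * B⁻ + + u * (-1ℤ * Q + (-1ℤ * (1ℤ + a)) * B⁻))))
                     (cong₂ _+_ L≡ R≡))
               (certificate κ a (+ u) N H Q B⁻))
        (0≤+ (0≤+ (0≤* {κ * κ} 0≤+m 0≤N) (0≤* {κ} 0≤+m (ℤ.i≤j⇒0≤j-i H≤cN)))
             (0≤+ 0≤κH+L+R (0≤+ (0≤* 0≤a 0≤B⁻) (0≤* {+ u} 0≤+m 0≤-Q-[1+a]B⁻))))))
      where
      1+a>0 : Positive (1ℤ + a)
      1+a>0 = positive (ℤ.+-mono-<-≤ (+<+ (ℕ.s≤s ℕ.z≤n)) 0≤a)
      certificate : ∀ κ a u N H Q B →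
        ((κ * κ) * N + κ * (κ * a * N - H)) +
          ((κ * H + ((1ℤ + u) * Q + (- a * B - Q))) + (a * B + u * (-1ℤ * Q + (-1ℤ * (1ℤ + a)) * B))) ≡
        (κ * κ) * N * (1ℤ + a) - u * B * (1ℤ + a)
      certificate = ℤ-Solver.solve-∀

  -- Here u ≥ 5 k², so the dichotomy gives 5 B⁻ ≤ N; and `B⁻` is the size of the star minus the
  -- number of its nonnegative members.
  star-bound : ∀ j {a Y} → All (_≤ a) Y → a + Σℤ Y ≡ 0ℤ →
    5 ℕ.* (suc j ℕ.* suc j) ℕ.+ suc j ℕ.≤ length Y →
    + 5 * + (length Y C j) ≤ ∑C (suc j) ν (a ∷ Y) + + 5 * ∑C j (λ s → ν (a + s)) Y
  star-bound j {a} {Y} Y≤ sum≡0 large = ℤ.0≤i-j⇒j≤i (subst (0ℤ ≤_)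
    (≡.trans (cong (λ b → N - + 5 * b) B⁻≡) (lemma N p (+ (length Y C j))))
    (ℤ.i≤j⇒0≤j-i 5B⁻≤N))
    where
    K = suc j ℕ.* suc j
    u = length Y ℕ.∸ suc j
    |Y|≡ : length Y ≡ suc j ℕ.+ u
    |Y|≡ = sym (ℕ.m+[n∸m]≡n (ℕ.≤-trans (ℕ.m≤n+m (suc j) (5 ℕ.* K)) large))
    open Dichotomy Y≤ sum≡0 j u |Y|≡ using (N; B⁻; 0≤B⁻; dichotomy)
    p = ∑C j (λ s → ν (a + s)) Y
    5K≤u : 5 ℕ.* K ℕ.≤ u
    5K≤u = subst (ℕ._≤ u) (ℕ.m+n∸n≡m (5 ℕ.* K) (suc j)) (ℕ.∸-monoˡ-≤ (suc j) large)
    5B⁻≤N : + 5 * B⁻ ≤ N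
    5B⁻≤N = ℤ.*-cancelˡ-≤-pos (+ 5 * B⁻) N (+ K) (begin
      + K * (+ 5 * B⁻)   ≡⟨ swap-factors (+ K) B⁻ ⟩
      + 5 * + K * B⁻     ≡⟨ cong (_* B⁻) (ℤ.pos-* 5 K) ⟨
      + (5 ℕ.* K) * B⁻   ≤⟨ ℤ.*-monoʳ-≤-nonNeg B⁻ {{nonNegative 0≤B⁻}} (+≤+ 5K≤u) ⟩
      + u * B⁻           ≤⟨ dichotomy ⟩
      + K * N            ∎)
      where
      open ℤ.≤-Reasoning
      swap-factors : ∀ k b → k * (+ 5 * b) ≡ + 5 * k * b
      swap-factors = ℤ-Solver.solve-∀
    B⁻≡ : B⁻ ≡ + (length Y C j) + -1ℤ * p
    B⁻≡ = ≡.trans (∑C-+ (λ _ → 1ℤ) (λ s → -1ℤ * ν (a + s)) j Y)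
      (cong₂ _+_ (∑C-1 j Y) (∑C-*ˡ -1ℤ (λ s → ν (a + s)) j Y))
    lemma : ∀ N p b → N - + 5 * (b + -1ℤ * p) ≡ N + + 5 * p - + 5 * b
    lemma = ℤ-Solver.solve-∀

  -- Reordering and restricting lists.

  ∑C-↭ : ∀ f k {X Y} → X ↭ Y → ∑C k f X ≡ ∑C k f Y
  ∑C-↭ f zero    _            = ≡.refl
  ∑C-↭ f (suc k) refl         = ≡.refl
  ∑C-↭ f (suc k) (prep x p)   = cong₂ _+_ (∑C-↭ (λ s → f (x + s)) k p) (∑C-↭ f (suc k) p)
  ∑C-↭ f (suc k) (trans p q)  = ≡.trans (∑C-↭ f (suc k) p) (∑C-↭ f (suc k) q)
  ∑C-↭ f (suc zero) {_ ∷ _ ∷ X} {_ ∷ _ ∷ Y} (swap x y p) = ≡.trans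
    (x∙yz≈y∙xz (f (x + 0ℤ)) (f (y + 0ℤ)) (∑C 1 f X))
    (cong (λ c → f (y + 0ℤ) + (f (x + 0ℤ) + c)) (∑C-↭ f 1 p))
  -- The sets fall into four groups, by which of `x` and `y` they contain; the swap exchanges the
  -- two middle groups.
  ∑C-↭ f (suc (suc k)) {_ ∷ _ ∷ X} {_ ∷ _ ∷ Y} (swap x y p) = begin
    (∑C k (λ s → f (x + (y + s))) X + ∑C (suc k) f₁ X) + (∑C (suc k) f₂ X + ∑C (2 ℕ.+ k) f X)
      ≡⟨ interchange (∑C k (λ s → f (x + (y + s))) X) (∑C (suc k) f₁ X) (∑C (suc k) f₂ X) (∑C (2 ℕ.+ k) f X) ⟩
    (∑C k (λ s → f (x + (y + s))) X + ∑C (suc k) f₂ X) + (∑C (suc k) f₁ X + ∑C (2 ℕ.+ k) f X)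
      ≡⟨ cong₂ _+_
           (cong₂ _+_ (≡.trans (∑C-cong k X λ s → cong f (x∙yz≈y∙xz x y s)) (∑C-↭ (λ s → f (y + (x + s))) k p))
                      (∑C-↭ f₂ (suc k) p))
           (cong₂ _+_ (∑C-↭ f₁ (suc k) p) (∑C-↭ f (2 ℕ.+ k) p)) ⟩
    (∑C k (λ s → f (y + (x + s))) Y + ∑C (suc k) f₂ Y) + (∑C (suc k) f₁ Y + ∑C (2 ℕ.+ k) f Y) ∎
    where
    open ≡.≡-Reasoning
    f₁ = λ s → f (x + s)
    f₂ = λ s → f (y + s)

  Σℤ-↭ : ∀ {X Y} → X ↭ Y → Σℤ X ≡ Σℤ Y
  Σℤ-↭ refl         = ≡.refl
  Σℤ-↭ (prep x p)   = cong (_+_ x) (Σℤ-↭ p)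
  Σℤ-↭ {_ ∷ _ ∷ X} (swap x y p) = ≡.trans (x∙yz≈y∙xz x y (Σℤ X)) (cong (λ s → y + (x + s)) (Σℤ-↭ p))
  Σℤ-↭ (trans p q)  = ≡.trans (Σℤ-↭ p) (Σℤ-↭ q)

  Σℤ-++ : ∀ X Y → Σℤ (X ++ Y) ≡ Σℤ X + Σℤ Y
  Σℤ-++ []      Y = sym (ℤ.+-identityˡ (Σℤ Y))
  Σℤ-++ (x ∷ X) Y = ≡.trans (cong (_+_ x) (Σℤ-++ X Y)) (sym (ℤ.+-assoc x (Σℤ X) (Σℤ Y)))

  i≤+nonneg : ∀ {i j} → 0ℤ ≤ j → i ≤ j + i
  i≤+nonneg {i} {j} 0≤j = subst (_≤ j + i) (ℤ.+-identityˡ i) (ℤ.+-monoˡ-≤ i 0≤j)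

  -- The sets that meet `T` contribute a nonnegative amount and are dropped.
  ∑C-++ʳ : ∀ k {f} T R → All (_≤ a) (T ++ R) → (∀ s → 0ℤ ≤ f s) → ∑C k f R ≤ ∑C k f (T ++ R)
  ∑C-++ʳ zero    T       R TR≤       0≤f = ℤ.≤-refl
  ∑C-++ʳ (suc k) []      R TR≤       0≤f = ℤ.≤-refl
  ∑C-++ʳ (suc k) (t ∷ T) R (_ ∷ TR≤) 0≤f = ℤ.≤-trans (∑C-++ʳ (suc k) T R TR≤ 0≤f)
    (i≤+nonneg (∑C-nonneg k TR≤ λ s _ → 0≤f (t + s)))

  maximum : ∀ x X → ∃₂ λ m Y → x ∷ X ↭ m ∷ Y × All (_≤ m) Y
  maximum x []      = x , [] , refl , []
  maximum x (z ∷ X) with maximum z X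
  ... | m , Y , p , Y≤m with ℤ.≤-total x m
  ...   | inj₁ x≤m = m , x ∷ Y , trans (prep x p) (swap x m refl) , x≤m ∷ Y≤m
  ...   | inj₂ m≤x = x , m ∷ Y , prep x p , m≤x ∷ All.map (λ y≤m → ℤ.≤-trans y≤m m≤x) Y≤m

  -- Estimates for binomial coefficients.

  C-pos : ∀ n k → k ℕ.≤ n → 0 ℕ.< n C k
  C-pos n       zero    _         = s≤s z≤n
  C-pos (suc n) (suc k) (s≤s k≤n) = subst (0 ℕ.<_) (nCk+nC[k+1]≡[n+1]C[k+1] n k)
    (ℕ.≤-trans (C-pos n k k≤n) (ℕ.m≤m+n _ _))

  C-monoˡ-≤ : ∀ {m n} k → m ℕ.≤ n → m C k ℕ.≤ n C k
  C-monoˡ-≤ zero m≤n = ℕ.≤-refl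
  C-monoˡ-≤ {n = n} (suc k) z≤n = subst (ℕ._≤ n C suc k) (sym (k>n⇒nCk≡0 {0} {suc k} (s≤s z≤n))) z≤n
  C-monoˡ-≤ (suc k) (s≤s {m} {n} m≤n) = subst₂ ℕ._≤_
    (nCk+nC[k+1]≡[n+1]C[k+1] m k) (nCk+nC[k+1]≡[n+1]C[k+1] n k)
    (ℕ.+-mono-≤ (C-monoˡ-≤ k m≤n) (C-monoˡ-≤ (suc k) m≤n))

  C-absorb : ∀ n k → suc k ℕ.* (suc n C suc k) ≡ suc n ℕ.* (n C k)
  C-absorb n       zero    = ≡.trans (ℕ.*-identityˡ _) (≡.trans (nC1≡n (suc n)) (sym (ℕ.*-identityʳ (suc n))))
  C-absorb zero    (suc k) = ≡.trans (cong (ℕ._*_ (2 ℕ.+ k)) (k>n⇒nCk≡0 {1} {2 ℕ.+ k} (s≤s (s≤s z≤n))))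
    (≡.trans (ℕ.*-zeroʳ (2 ℕ.+ k)) (sym (cong (ℕ._+ 0) (k>n⇒nCk≡0 {0} {suc k} (s≤s z≤n)))))
  C-absorb (suc n) (suc k) = begin
    (2 ℕ.+ k) ℕ.* ((2 ℕ.+ n) C (2 ℕ.+ k))
      ≡⟨ cong (ℕ._*_ (2 ℕ.+ k)) (nCk+nC[k+1]≡[n+1]C[k+1] (suc n) (suc k)) ⟨
    (2 ℕ.+ k) ℕ.* (c₁ ℕ.+ c₂)
      ≡⟨ split k c₁ c₂ ⟩
    c₁ ℕ.+ (suc k ℕ.* c₁ ℕ.+ (2 ℕ.+ k) ℕ.* c₂)
      ≡⟨ cong (ℕ._+_ c₁) (cong₂ ℕ._+_ (C-absorb n k) (C-absorb n (suc k))) ⟩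
    c₁ ℕ.+ (suc n ℕ.* (n C k) ℕ.+ suc n ℕ.* (n C suc k))
      ≡⟨ cong (ℕ._+_ c₁) (ℕ.*-distribˡ-+ (suc n) (n C k) (n C suc k)) ⟨
    c₁ ℕ.+ suc n ℕ.* (n C k ℕ.+ n C suc k)
      ≡⟨ cong (λ c → c₁ ℕ.+ suc n ℕ.* c) (nCk+nC[k+1]≡[n+1]C[k+1] n k) ⟩
    (2 ℕ.+ n) ℕ.* c₁ ∎
    where
    open ≡.≡-Reasoning
    c₁ = suc n C suc k
    c₂ = suc n C (2 ℕ.+ k)
    split : ∀ k a b → (2 ℕ.+ k) ℕ.* (a ℕ.+ b) ≡ a ℕ.+ (suc k ℕ.* a ℕ.+ (2 ℕ.+ k) ℕ.* b)
    split = ℕ-Solver.solve-∀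

  -- Pascal's rule removes the i elements one at a time, and each removal loses at most C(q, k).
  C-drop : ∀ i p q k → i ℕ.+ p ℕ.≤ suc q → (i ℕ.+ p) C suc k ℕ.≤ (p C suc k) ℕ.+ i ℕ.* (q C k)
  C-drop zero    p q k _           = ℕ.m≤m+n _ _
  C-drop (suc i) p q k (s≤s i+p≤q) = begin
    suc (i ℕ.+ p) C suc k                              ≡⟨ nCk+nC[k+1]≡[n+1]C[k+1] (i ℕ.+ p) k ⟨
    ((i ℕ.+ p) C k) ℕ.+ ((i ℕ.+ p) C suc k)            ≤⟨ ℕ.+-mono-≤ (C-monoˡ-≤ k i+p≤q) (C-drop i p q k (ℕ.m≤n⇒m≤1+n i+p≤q)) ⟩
    (q C k) ℕ.+ ((p C suc k) ℕ.+ i ℕ.* (q C k))        ≡⟨ ℕ+.x∙yz≈y∙xz (q C k) (p C suc k) (i ℕ.* (q C k)) ⟩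
    (p C suc k) ℕ.+ suc i ℕ.* (q C k)                  ∎
    where
    open ℕ.≤-Reasoning

  -- Take j = k + 1 and q = i + p - 1. By absorption the loss i C(q, k) is the fraction j i / (i +
  -- p) of C(i + p, j), which is at most one half.
  C-drop-half : ∀ j i p → 2 ℕ.* (j ℕ.* i) ℕ.≤ i ℕ.+ p → (i ℕ.+ p) C j ℕ.≤ 2 ℕ.* (p C j)
  C-drop-half zero    i       p _     = s≤s z≤n
  C-drop-half (suc k) zero    p _     = ℕ.m≤m+n _ _
  C-drop-half (suc k) i@(suc i′) p large = ℕ.+-cancelʳ-≤ B B (2 ℕ.* B′) (begin
    B ℕ.+ B                            ≡⟨ cong (ℕ._+_ B) (ℕ.+-identityʳ B) ⟨
    2 ℕ.* B                            ≤⟨ ℕ.*-monoʳ-≤ 2 (C-drop i p q k ℕ.≤-refl) ⟩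
    2 ℕ.* (B′ ℕ.+ i ℕ.* c)             ≡⟨ ℕ.*-distribˡ-+ 2 B′ (i ℕ.* c) ⟩
    2 ℕ.* B′ ℕ.+ 2 ℕ.* (i ℕ.* c)       ≤⟨ ℕ.+-monoʳ-≤ (2 ℕ.* B′) 2ic≤B ⟩
    2 ℕ.* B′ ℕ.+ B                     ∎)
    where
    open ℕ.≤-Reasoning
    q = i′ ℕ.+ p
    B = (i ℕ.+ p) C suc k
    B′ = p C suc k
    c = q C k
    regroup : ∀ k i c → k ℕ.* (2 ℕ.* (i ℕ.* c)) ≡ 2 ℕ.* (k ℕ.* i) ℕ.* c
    regroup = ℕ-Solver.solve-∀
    2ic≤B : 2 ℕ.* (i ℕ.* c) ℕ.≤ B
    2ic≤B = ℕ.*-cancelˡ-≤ (suc k) (begin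
      suc k ℕ.* (2 ℕ.* (i ℕ.* c))    ≡⟨ regroup (suc k) i c ⟩
      2 ℕ.* (suc k ℕ.* i) ℕ.* c      ≤⟨ ℕ.*-monoˡ-≤ c large ⟩
      suc q ℕ.* c                    ≡⟨ C-absorb q k ⟨
      suc k ℕ.* B                    ∎)

  -- The surplus of nonnegative sets when the star has a negative member.

  ν-mono : ∀ {s t} → s ≤ t → ν s ≤ ν t
  ν-mono (+≤+ _)        = ℤ.≤-refl
  ν-mono -≤+            = +≤+ z≤n
  ν-mono (-≤- _)        = ℤ.≤-refl

  -- `r` will be the number of elements outside a negative star set. Since 1 and k are at most k², 5
  -- k² + k + k + 1 fits into 8 k². Strictness leaves room for splitting off a maximum later.
  size-bound : ∀ j r → 8 ℕ.* (suc j ℕ.* suc j) ℕ.≤ suc (j ℕ.+ r) →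
    5 ℕ.* (suc j ℕ.* suc j) ℕ.+ suc j ℕ.< r
  size-bound j r large = ℕ.+-cancelʳ-≤ k (suc (5 ℕ.* K ℕ.+ k)) r (begin
    1 ℕ.+ (5 ℕ.* K ℕ.+ k) ℕ.+ k    ≤⟨ ℕ.+-mono-≤ (ℕ.+-mono-≤ 1≤K (ℕ.+-monoʳ-≤ (5 ℕ.* K) k≤K)) k≤K ⟩
    K ℕ.+ (5 ℕ.* K ℕ.+ K) ℕ.+ K    ≡⟨ lemma K ⟩
    8 ℕ.* K                        ≤⟨ large ⟩
    k ℕ.+ r                        ≡⟨ ℕ.+-comm k r ⟩
    r ℕ.+ k                        ∎)
    where
    open ℕ.≤-Reasoning
    k = suc j
    K = k ℕ.* k
    1≤K : 1 ℕ.≤ K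
    1≤K = s≤s z≤n
    k≤K : k ℕ.≤ K
    k≤K = ℕ.m≤m*n k k
    lemma : ∀ K → K ℕ.+ (5 ℕ.* K ℕ.+ K) ℕ.+ K ≡ 8 ℕ.* K
    lemma = ℕ-Solver.solve-∀

  -- Lowering one element that is not the maximum makes the total zero, so that
  -- star-bound applies.
  positive-sum-bound : ∀ j {m l L} → All (_≤ m) (l ∷ L) → 0ℤ ≤ m + Σℤ (l ∷ L) →
    5 ℕ.* (suc j ℕ.* suc j) ℕ.+ suc j ℕ.≤ length (l ∷ L) →
    + 5 * + (length (l ∷ L) C j) ≤ + 6 * ∑C (suc j) ν (m ∷ l ∷ L)
  positive-sum-bound j {m} {l} {L} (l≤m ∷ L≤m) 0≤σ large = begin
    + 5 * + (length (l ∷ L) C j)    ≤⟨ star-bound j (l′≤m ∷ L≤m) sum≡0 large ⟩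
    (p + q) + + 5 * p               ≡⟨ regroup p q ⟩
    (+ 6 * (p + q)) - + 5 * q       ≤⟨ ℤ.i-j≤i _ (+ 5 * q) {{nonNegative (0≤* {+ 5} 0≤+m 0≤q)}} ⟩
    + 6 * (p + q)                   ≤⟨ ℤ.*-monoˡ-≤-nonNeg (+ 6) p+q≤ ⟩
    + 6 * ∑C (suc j) ν (m ∷ l ∷ L)  ∎
    where
    open ℤ.≤-Reasoning
    σ = m + (l + Σℤ L)
    l′ = l - σ
    l′≤l : l′ ≤ l
    l′≤l = ℤ.i-j≤i l σ {{nonNegative 0≤σ}}
    l′≤m : l′ ≤ m
    l′≤m = ℤ.≤-trans l′≤l l≤m
    cancel : ∀ m l s → m + ((l - (m + (l + s))) + s) ≡ 0ℤ
    cancel = ℤ-Solver.solve-∀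
    sum≡0 : m + Σℤ (l′ ∷ L) ≡ 0ℤ
    sum≡0 = cancel m l (Σℤ L)
    p = ∑C j (λ s → ν (m + s)) (l′ ∷ L)
    q = ∑C (suc j) ν (l′ ∷ L)
    0≤q : 0ℤ ≤ q
    0≤q = ∑C-nonneg (suc j) (l′≤m ∷ L≤m) λ s _ → 0≤ν s
    regroup : ∀ p q → (p + q) + + 5 * p ≡ + 6 * (p + q) - + 5 * q
    regroup = ℤ-Solver.solve-∀
    p+q≤ : p + q ≤ ∑C (suc j) ν (m ∷ l ∷ L)
    p+q≤ = begin
      ∑C (suc j) ν (m ∷ l′ ∷ L)   ≡⟨ ∑C-↭ ν (suc j) (swap m l′ refl) ⟩
      -- With the lowered entry in front, only the sums that contain it change.
      ∑C (suc j) ν (l′ ∷ m ∷ L)   ≤⟨ ℤ.+-monoˡ-≤ (∑C (suc j) ν (m ∷ L)) (∑C-mono j (ℤ.≤-refl ∷ L≤m) λ s _ → ν-mono (ℤ.+-monoˡ-≤ s l′≤l)) ⟩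
      ∑C (suc j) ν (l ∷ m ∷ L)    ≡⟨ ∑C-↭ ν (suc j) (swap l m refl) ⟩
      ∑C (suc j) ν (m ∷ l ∷ L)    ∎

  -- The star bound is used for the whole list and, through `positive-sum-bound`, for `R`, whose
  -- total is positive because that of `a` and `T` is negative. The k-sets inside `R` avoid `a`, so
  -- they add to the nonnegative members of the star.
  many-nonneg-subsets : ∀ j {a Y T R} → All (_≤ a) Y → a + Σℤ Y ≡ 0ℤ →
    8 ℕ.* (suc j ℕ.* suc j) ℕ.≤ suc (length Y) →
    Y ↭ T ++ R → length T ≡ j → a + Σℤ T < 0ℤ →
    + (length Y C j) < ∑C (suc j) ν (a ∷ Y)
  many-nonneg-subsets j {a} {Y} {T} {R} Y≤ sum≡0 large Y↭T++R |T|≡j neg = go R Y↭T++R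
    where
    open ℤ.≤-Reasoning
    k = suc j
    K = k ℕ.* k
    |Y|≡ : ∀ {R} → Y ↭ T ++ R → length Y ≡ j ℕ.+ length R
    |Y|≡ {R} p = ≡.trans (↭-length p) (≡.trans (length-++ T) (cong (ℕ._+ length R) |T|≡j))

    |R|> : ∀ {R} → Y ↭ T ++ R → 5 ℕ.* K ℕ.+ k ℕ.< length R
    |R|> {R} p = size-bound j (length R) (subst (λ n → 8 ℕ.* K ℕ.≤ suc n) (|Y|≡ p) large)

    0≤ΣR : ∀ {R} → Y ↭ T ++ R → 0ℤ ≤ Σℤ R
    0≤ΣR {R} p = subst (0ℤ ≤_) ΣR≡ (ℤ.i≤j⇒0≤j-i (ℤ.<⇒≤ neg))
      where
      rearrange : ∀ a t r → (a + (t + r)) - (a + t) ≡ r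
      rearrange = ℤ-Solver.solve-∀
      ΣR≡ : 0ℤ - (a + Σℤ T) ≡ Σℤ R
      ΣR≡ = ≡.trans
        (cong (_- (a + Σℤ T)) (≡.trans (sym sum≡0) (cong (_+_ a) (≡.trans (Σℤ-↭ p) (Σℤ-++ T R)))))
        (rearrange a (Σℤ T) (Σℤ R))

    finish : ∀ {R m l L} → Y ↭ T ++ R → R ↭ m ∷ l ∷ L → All (_≤ m) (l ∷ L) → + (length Y C j) < ∑C (suc j) ν (a ∷ Y)
    finish {R} {m} {l} {L} p q L≤m = ℤ.*-cancelˡ-<-nonNeg (+ 72) (begin-strict
      + 72 * B                                                                 ≡⟨ ℤ.+-identityʳ _ ⟨
      + 72 * B + 0ℤ                                                            <⟨ ℤ.+-monoʳ-< (+ 72 * B) 0<certificate ⟩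
      + 72 * B + (((+ 12 * (N₁ + N₀ + + 5 * N₁ - + 5 * B) + + 60 * (N₀ - N′)) + + 10 * (+ 6 * N′ - + 5 * B′)) + (+ 25 * (+ 2 * B′ - B) + + 13 * B))
                                                                               ≡⟨ certificate B B′ N₁ N₀ N′ ⟩
      + 72 * (N₁ + N₀)                                                         ∎)
      where
      B = + (length Y C j)
      B′ = + (length (l ∷ L) C j)
      N₁ = ∑C j (λ s → ν (a + s)) Y
      N₀ = ∑C (suc j) ν Y
      N′ = ∑C (suc j) ν (m ∷ l ∷ L)
      |Y|≡k+|L| : length Y ≡ suc j ℕ.+ length (l ∷ L)
      |Y|≡k+|L| = ≡.trans (|Y|≡ p) (≡.trans (cong (ℕ._+_ j) (↭-length q)) (ℕ.+-suc j _))
      large′ : 5 ℕ.* K ℕ.+ k ℕ.< length Y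
      large′ = ℕ.≤-trans (|R|> p) (subst (length R ℕ.≤_) (sym (|Y|≡ p)) (ℕ.m≤n+m (length R) j))
      e₁ : + 5 * B ≤ N₁ + N₀ + + 5 * N₁
      e₁ = star-bound j Y≤ sum≡0 (ℕ.<⇒≤ large′)
      e₂ : N′ ≤ N₀
      e₂ = begin
        N′                      ≡⟨ ∑C-↭ ν (suc j) q ⟨
        ∑C (suc j) ν R          ≤⟨ ∑C-++ʳ (suc j) T R (All-resp-↭ p Y≤) 0≤ν ⟩
        ∑C (suc j) ν (T ++ R)   ≡⟨ ∑C-↭ ν (suc j) p ⟨
        N₀                      ∎
      e₃ : + 5 * B′ ≤ + 6 * N′
      e₃ = positive-sum-bound j L≤m (subst (0ℤ ≤_) (Σℤ-↭ q) (0≤ΣR p))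
        (ℕ.≤-pred (subst (5 ℕ.* K ℕ.+ k ℕ.<_) (↭-length q) (|R|> p)))
      -- Passing from `Y` to `l ∷ L` deletes k elements: the j of `T` and the maximum `m`.
      e₄ : B ≤ + 2 * B′
      e₄ = subst (B ≤_) (ℤ.pos-* 2 (length (l ∷ L) C j)) (+≤+ (subst (λ n → n C j ℕ.≤ 2 ℕ.* (length (l ∷ L) C j)) (sym |Y|≡k+|L|)
        (C-drop-half j (suc j) (length (l ∷ L)) (subst (2 ℕ.* (j ℕ.* k) ℕ.≤_) |Y|≡k+|L| 2jk≤|Y|))))
        where
        2jk≤|Y| : 2 ℕ.* (j ℕ.* k) ℕ.≤ length Y
        2jk≤|Y| = ℕ.≤-trans (ℕ.*-mono-≤ {2} {5} (s≤s (s≤s z≤n)) (ℕ.*-monoˡ-≤ k (ℕ.n≤1+n j)))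
          (ℕ.≤-trans (ℕ.m≤m+n (5 ℕ.* K) k) (ℕ.<⇒≤ large′))
      0<B : 0ℤ < B
      0<B = +<+ (C-pos (length Y) j (subst (j ℕ.≤_) (sym (|Y|≡ p)) (ℕ.m≤m+n j (length R))))
      -- A combination of e₁, …, e₄ eliminates N′ and B′ from 72 (N − B), leaving 13 B.
      0<certificate : 0ℤ < ((+ 12 * (N₁ + N₀ + + 5 * N₁ - + 5 * B) + + 60 * (N₀ - N′)) + + 10 * (+ 6 * N′ - + 5 * B′)) + (+ 25 * (+ 2 * B′ - B) + + 13 * B)
      0<certificate = ℤ.+-mono-≤-<
        (0≤+ (0≤+ (0≤* {+ 12} 0≤+m (ℤ.i≤j⇒0≤j-i e₁)) (0≤* {+ 60} 0≤+m (ℤ.i≤j⇒0≤j-i e₂)))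
             (0≤* {+ 10} 0≤+m (ℤ.i≤j⇒0≤j-i e₃)))
        (ℤ.+-mono-≤-< (0≤* {+ 25} 0≤+m (ℤ.i≤j⇒0≤j-i e₄)) (ℤ.*-monoˡ-<-pos (+ 13) 0<B))
      certificate : ∀ B B′ N₁ N₀ N′ →
        + 72 * B + (((+ 12 * (N₁ + N₀ + + 5 * N₁ - + 5 * B) + + 60 * (N₀ - N′)) + + 10 * (+ 6 * N′ - + 5 * B′)) + (+ 25 * (+ 2 * B′ - B) + + 13 * B))
        ≡ + 72 * (N₁ + N₀)
      certificate = ℤ-Solver.solve-∀

    -- The size bound leaves at least two elements in the remainder: a maximum `m` and an entry `l`
    -- that can be lowered.
    go : ∀ R′ → Y ↭ T ++ R′ → + (length Y C j) < ∑C (suc j) ν (a ∷ Y)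
    go []       p with () ← |R|> p
    go (r ∷ R′) p with maximum r R′
    ... | m , []    , q , _   with s≤s () ← subst (5 ℕ.* K ℕ.+ k ℕ.<_) (↭-length q) (|R|> p)
    ... | m , l ∷ L , q , L≤m = finish p q L≤m

-- From lists of integers to subsets of the index set.

module SubsetSum (M : RawMonoid 0ℓ 0ℓ) where
  open RawMonoid M
  open RawMonoidSum M public using (sum)

  -- The encoding of `sumOver`, for the integers and the rationals at once.
  sumIn : ∀ {n} → Vector Carrier n → Subset n → Carrier
  sumIn v S = sum λ i → if lookup S i then v i else ε

module Sumℤ = SubsetSum ℤ.+-0-rawMonoid
module Sumℚ = SubsetSum ℚ.+-0-rawMonoid
open Sumℤ using () renaming (sum to sumℤ; sumIn to sumInℤ)
open Sumℚ using () renaming (sum to sumℚ; sumIn to sumInℚ)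

-- Branches in the same order as `∑C`, so that the two agree term by term.
ksubsets : ∀ n → ℕ → List (Subset n)
ksubsets n       zero    = Subset.⊥ ∷ []
ksubsets zero    (suc k) = []
ksubsets (suc n) (suc k) = map (inside ∷_) (ksubsets n k) ++ map (outside ∷_) (ksubsets n (suc k))

∈-ksubsets⁻ : ∀ n k {S} → S List.∈ ksubsets n k → ∣ S ∣ ≡ k
∈-ksubsets⁻ n       zero    (here ≡.refl) = Subset.∣⊥∣≡0 n
∈-ksubsets⁻ (suc n) (suc k) S∈ with ∈-++⁻ (map (inside ∷_) (ksubsets n k)) S∈
... | inj₁ p with _ , q , ≡.refl ← ∈-map⁻ (inside ∷_) p = cong suc (∈-ksubsets⁻ n k q)
... | inj₂ p with _ , q , ≡.refl ← ∈-map⁻ (outside ∷_) p = ∈-ksubsets⁻ n (suc k) q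

ksubsets-unique : ∀ n k → Unique (ksubsets n k)
ksubsets-unique n       zero    = [] ∷ []
ksubsets-unique zero    (suc k) = []
ksubsets-unique (suc n) (suc k) = Unique.++⁺
  (Unique.map⁺ ∷-injectiveʳ (ksubsets-unique n k))
  (Unique.map⁺ ∷-injectiveʳ (ksubsets-unique n (suc k)))
  λ { (p , q) → disjoint p q }
  where
  disjoint : ∀ {S} → S List.∈ map (inside ∷_) (ksubsets n k) →
    ¬ (S List.∈ map (outside ∷_) (ksubsets n (suc k)))
  disjoint p q with _ , _ , ≡.refl ← ∈-map⁻ (inside ∷_) p | _ , _ , () ← ∈-map⁻ (outside ∷_) q

length-ksubsets : ∀ n k → length (ksubsets n k) ≡ n C k
length-ksubsets n       zero    = ≡.refl
length-ksubsets zero    (suc k) = sym (k>n⇒nCk≡0 {0} {suc k} (s≤s z≤n))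
length-ksubsets (suc n) (suc k) = ≡.trans (length-++ (map (inside ∷_) (ksubsets n k)))
  (≡.trans (cong₂ ℕ._+_ (≡.trans (length-map _ (ksubsets n k)) (length-ksubsets n k))
                        (≡.trans (length-map _ (ksubsets n (suc k))) (length-ksubsets n (suc k))))
           (nCk+nC[k+1]≡[n+1]C[k+1] n k))

-- Each element of `xs` is cut out of `ys` in turn; distinctness keeps the later ones in what
-- remains.
length-mono-⊆ : ∀ {A : Set} {xs ys : List A} → Unique xs →
  (∀ {x} → x List.∈ xs → x List.∈ ys) → length xs ℕ.≤ length ys
length-mono-⊆ [] _ = z≤n
length-mono-⊆ {xs = x ∷ xs} (x∉xs ∷ xs!) xs⊆ys
  with as , bs , ≡.refl ← ∈-∃++ (xs⊆ys (here ≡.refl)) = begin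
    suc (length xs)                  ≤⟨ s≤s (length-mono-⊆ xs! ⊆rest) ⟩
    suc (length (as ++ bs))          ≡⟨ cong suc (length-++ as) ⟩
    suc (length as ℕ.+ length bs)    ≡⟨ ℕ.+-suc (length as) (length bs) ⟨
    length as ℕ.+ suc (length bs)    ≡⟨ length-++ as ⟨
    length (as ++ x ∷ bs)            ∎
  where
  open ℕ.≤-Reasoning
  ⊆rest : ∀ {z} → z List.∈ xs → z List.∈ as ++ bs
  ⊆rest z∈xs with ∈-++⁻ as (xs⊆ys (there z∈xs))
  ... | inj₁ z∈as           = ∈-++⁺ˡ z∈as
  ... | inj₂ (there z∈bs)   = ∈-++⁺ʳ as z∈bs
  ... | inj₂ (here ≡.refl)  = contradiction ≡.refl (All.lookup x∉xs z∈xs)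

sumInℤ-⊥ : ∀ {n} (z : Vector ℤ n) → sumInℤ z Subset.⊥ ≡ 0ℤ
sumInℤ-⊥ {zero}  z = ≡.refl
sumInℤ-⊥ {suc n} z = ≡.trans (ℤ.+-identityˡ _) (sumInℤ-⊥ (z ∘ Fin.suc))

Σℤ-tabulate : ∀ {n} (z : Vector ℤ n) → Σℤ (tabulate z) ≡ sumℤ z
Σℤ-tabulate {zero}  z = ≡.refl
Σℤ-tabulate {suc n} z = cong (ℤ._+_ (z Fin.zero)) (Σℤ-tabulate (z ∘ Fin.suc))

∑C-tabulate : ∀ {n} k f (z : Vector ℤ n) →
  ∑C k f (tabulate z) ≡ Σℤ (map (f ∘ sumInℤ z) (ksubsets n k))
∑C-tabulate zero f z = sym (≡.trans (ℤ.+-identityʳ _) (cong f (sumInℤ-⊥ z)))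
∑C-tabulate {zero}  (suc k) f z = ≡.refl
∑C-tabulate {suc n} (suc k) f z = begin
  ∑C k (λ s → f (z₀ ℤ.+ s)) (tabulate z′) ℤ.+ ∑C (suc k) f (tabulate z′)
    ≡⟨ cong₂ ℤ._+_ (∑C-tabulate k (λ s → f (z₀ ℤ.+ s)) z′) (∑C-tabulate (suc k) f z′) ⟩
  Σℤ (map (λ S → f (z₀ ℤ.+ sumInℤ z′ S)) ins) ℤ.+ Σℤ (map (f ∘ sumInℤ z′) outs)
    ≡⟨ cong₂ (λ xs ys → Σℤ xs ℤ.+ Σℤ ys)
         (map-∘ {g = F} {f = inside ∷_} ins)
         (≡.trans (map-cong (λ S → cong f (sym (ℤ.+-identityˡ (sumInℤ z′ S)))) outs) (map-∘ {g = F} {f = outside ∷_} outs)) ⟩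
  Σℤ (map F (map (inside ∷_) ins)) ℤ.+ Σℤ (map F (map (outside ∷_) outs))
    ≡⟨ Σℤ-++ (map F (map (inside ∷_) ins)) _ ⟨
  Σℤ (map F (map (inside ∷_) ins) ++ map F (map (outside ∷_) outs))
    ≡⟨ cong Σℤ (map-++ F (map (inside ∷_) ins) _) ⟨
  Σℤ (map F (ksubsets (suc n) (suc k))) ∎
  where
  open ≡.≡-Reasoning
  z₀ = z Fin.zero
  z′ = z ∘ Fin.suc
  ins = ksubsets n k
  outs = ksubsets n (suc k)
  F : Subset (suc n) → ℤ
  F = f ∘ sumInℤ z

Σν≡count : ∀ {A : Set} (g : A → ℤ) xs →
  Σℤ (map (ν ∘ g) xs) ≡ + length (filter (λ x → 0ℤ ℤ.≤? g x) xs)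
Σν≡count g []       = ≡.refl
Σν≡count g (x ∷ xs) with g x
... | + _      = cong (ℤ._+_ 1ℤ) (Σν≡count g xs)
... | -[1+ _ ] = ≡.trans (ℤ.+-identityˡ _) (Σν≡count g xs)

split-tabulate : ∀ {n} (S : Subset n) (z : Vector ℤ n) →
  ∃₂ λ T R → tabulate z ↭ T ++ R × length T ≡ ∣ S ∣ × Σℤ T ≡ sumInℤ z S
split-tabulate []            z = [] , [] , refl , ≡.refl , ≡.refl
split-tabulate (inside  ∷ S) z with split-tabulate S (z ∘ Fin.suc)
... | T , R , p , |T|≡ , ΣT≡ =
  _ ∷ T , R , prep _ p , cong suc |T|≡ , cong (ℤ._+_ (z Fin.zero)) ΣT≡
split-tabulate (outside ∷ S) z with split-tabulate S (z ∘ Fin.suc)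
... | T , R , p , |T|≡ , ΣT≡ =
  T , z Fin.zero ∷ R , trans (prep _ p) (↭-sym (shift _ T R)) , |T|≡ , ≡.trans ΣT≡ (sym (ℤ.+-identityˡ _))

-- Over the integers it is decidable whether the star has a negative member. Such a member supplies
-- the `T` of `many-nonneg-subsets`, and the resulting count is carried back to subsets.
star-or-many : ∀ n j (z : Vector ℤ (suc n)) → sumℤ z ≡ 0ℤ → (∀ i → z i ℤ.≤ z Fin.zero) →
  8 ℕ.* (suc j ℕ.* suc j) ℕ.≤ suc n →
  (∀ S → ∣ S ∣ ≡ j → 0ℤ ℤ.≤ sumInℤ z (inside ∷ S)) ⊎
  n C j ℕ.< length (filter (λ S → 0ℤ ℤ.≤? sumInℤ z S) (ksubsets (suc n) (suc j)))
star-or-many n j z sum≡0 z≤z₀ large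
  with Subset.anySubset? (λ S → (∣ S ∣ ℕ.≟ j) ×-dec (sumInℤ z (inside ∷ S) ℤ.<? 0ℤ))
... | no  none = inj₁ λ S |S|≡j → ℤ.≮⇒≥ λ neg → none (S , |S|≡j , neg)
... | yes (S , |S|≡j , neg) with split-tabulate S (z ∘ Fin.suc)
...   | T , R , p , |T|≡ , ΣT≡ = inj₂ (ℤ.drop‿+<+ (begin-strict
  + (n C j)                              ≡⟨ cong (λ m → + (m C j)) (length-tabulate (z ∘ Fin.suc)) ⟨
  + (length Y C j)                       <⟨ many-nonneg-subsets j {T = T} {R} Y≤ (≡.trans (Σℤ-tabulate z) sum≡0)
                                              (subst (λ m → 8 ℕ.* (suc j ℕ.* suc j) ℕ.≤ suc m) (sym (length-tabulate (z ∘ Fin.suc))) large)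
                                              p (≡.trans |T|≡ |S|≡j)
                                              (subst (λ s → z Fin.zero ℤ.+ s ℤ.< 0ℤ) (sym ΣT≡) neg) ⟩
  ∑C (suc j) ν (tabulate z)              ≡⟨ ∑C-tabulate (suc j) ν z ⟩
  Σℤ (map (ν ∘ sumInℤ z) (ksubsets (suc n) (suc j)))
                                         ≡⟨ Σν≡count (sumInℤ z) (ksubsets (suc n) (suc j)) ⟩
  + length (filter (λ S → 0ℤ ℤ.≤? sumInℤ z S) (ksubsets (suc n) (suc j))) ∎))
  where
  open ℤ.≤-Reasoning
  Y = tabulate (z ∘ Fin.suc)
  Y≤ : All (ℤ._≤ z Fin.zero) Y
  Y≤ = All.tabulate⁺ λ i → z≤z₀ (Fin.suc i)

-- Clearing denominators.

-- d is one less than the denominator.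
record Scaled (d : ℕ) (z : ℤ) (w : ℚ) : Set where
  constructor scaled
  field unscaled : mkℚᵘ z d ℚᵘ.≃ toℚᵘ w

module _ {d : ℕ} where

  scaled-0 : Scaled d 0ℤ 0ℚ
  scaled-0 = scaled (*≡* (sym (ℤ.*-zeroˡ (+ suc d))))

  scaled-+ : ∀ {z z′ w w′} → Scaled d z w → Scaled d z′ w′ → Scaled d (z ℤ.+ z′) (w ℚ.+ w′)
  scaled-+ {z} {z′} {w} {w′} (scaled p) (scaled q) = scaled (ℚᵘ.≃-trans (*≡* (common z z′ (+ suc d)))
    (ℚᵘ.≃-trans (ℚᵘ.+-cong p q) (ℚᵘ.≃-sym (ℚ.toℚᵘ-homo-+ w w′))))
    where
    common : ∀ a b d → (a ℤ.+ b) ℤ.* (d ℤ.* d) ≡ (a ℤ.* d ℤ.+ b ℤ.* d) ℤ.* d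
    common = ℤ-Solver.solve-∀

  scaled-sum : ∀ {n} {z : Vector ℤ n} {w : Vector ℚ n} → (∀ i → Scaled d (z i) (w i)) → Scaled d (sumℤ z) (sumℚ w)
  scaled-sum {zero}  _ = scaled-0
  scaled-sum {suc n} p = scaled-+ (p Fin.zero) (scaled-sum (p ∘ Fin.suc))

  scaled-sumIn : ∀ {n} {z : Vector ℤ n} {w : Vector ℚ n} → (∀ i → Scaled d (z i) (w i)) →
    ∀ S → Scaled d (sumInℤ z S) (sumInℚ w S)
  scaled-sumIn {z = z} {w} p S = scaled-sum λ i → choose (lookup S i) (p i)
    where
    choose : ∀ b {z w} → Scaled d z w → Scaled d (if b then z else 0ℤ) (if b then w else 0ℚ)
    choose true  p = p
    choose false _ = scaled-0

  scaled-mono-≤ : ∀ {z z′ w w′} → Scaled d z w → Scaled d z′ w′ → z ℤ.≤ z′ → w ℚ.≤ w′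
  scaled-mono-≤ (scaled p) (scaled q) z≤z′ = ℚ.toℚᵘ-cancel-≤ (ℚᵘ.≤-respˡ-≃ p (ℚᵘ.≤-respʳ-≃ q
    (*≤* (ℤ.*-monoʳ-≤-nonNeg (+ suc d) z≤z′))))

  scaled-cancel-≤ : ∀ {z z′ w w′} → Scaled d z w → Scaled d z′ w′ → w ℚ.≤ w′ → z ℤ.≤ z′
  scaled-cancel-≤ {z} {z′} (scaled p) (scaled q) w≤w′
    with *≤* le ← ℚᵘ.≤-respˡ-≃ (ℚᵘ.≃-sym p) (ℚᵘ.≤-respʳ-≃ (ℚᵘ.≃-sym q) (ℚ.toℚᵘ-mono-≤ w≤w′))
    = ℤ.*-cancelʳ-≤-pos z z′ (+ suc d) le

common-denominator : ∀ {n} (w : Vector ℚ n) → ∃₂ λ d (z : Vector ℤ n) → ∀ i → Scaled d (z i) (w i)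
common-denominator {zero}  w = 0 , (λ ()) , λ ()
common-denominator {suc n} w with common-denominator (w ∘ Fin.suc)
-- The new denominator is (d + 1)(e + 1), stored as its predecessor.
... | d , z , p = e ℕ.+ d ℕ.* suc e , z′ , p′
  where
  w₀ = w Fin.zero
  e = ℚᵘ.ℚᵘ.denominator-1 (toℚᵘ w₀)
  D≡ : + suc (e ℕ.+ d ℕ.* suc e) ≡ + suc d ℤ.* + suc e
  D≡ = ℤ.pos-* (suc d) (suc e)
  z′ : Vector ℤ (suc n)
  z′ Fin.zero    = (ℚᵘ.↥ toℚᵘ w₀) ℤ.* + suc d
  z′ (Fin.suc i) = z i ℤ.* + suc e
  reassoc : ∀ a b c → a ℤ.* b ℤ.* c ≡ a ℤ.* (b ℤ.* c)
  reassoc = ℤ-Solver.solve-∀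
  regroup : ∀ a b c → a ℤ.* b ℤ.* c ≡ a ℤ.* (c ℤ.* b)
  regroup = ℤ-Solver.solve-∀
  p′ : ∀ i → Scaled (e ℕ.+ d ℕ.* suc e) (z′ i) (w i)
  p′ Fin.zero    = scaled (*≡*
    (≡.trans (reassoc (ℚᵘ.↥ toℚᵘ w₀) (+ suc d) (+ suc e)) (cong (ℤ._*_ (ℚᵘ.↥ toℚᵘ w₀)) (sym D≡))))
  p′ (Fin.suc i) = scaled (ℚᵘ.≃-trans
    (*≡* (≡.trans (regroup (z i) (+ suc e) (+ suc d)) (cong (ℤ._*_ (z i)) (sym D≡)))) (Scaled.unscaled (p i)))

-- A positive common denominator preserves order and zero totals. The last clause is the direction
-- that carries lower bounds on the number of nonnegative sets from `z` to `w`.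
clear-denominators : ∀ {n} (w : Vector ℚ (suc n)) → sumℚ w ≡ 0ℚ → (∀ i → w i ℚ.≤ w Fin.zero) →
  ∃[ z ] sumℤ z ≡ 0ℤ × (∀ i → z i ℤ.≤ z Fin.zero) × (∀ S → 0ℤ ℤ.≤ sumInℤ z S → 0ℚ ℚ.≤ sumInℚ w S)
clear-denominators w Σw≡0 w≤w₀ with common-denominator w
... | d , z , z∼w = z ,
  ℤ.≤-antisym (scaled-cancel-≤ (scaled-sum z∼w) scaled-0 (ℚ.≤-reflexive Σw≡0))
              (scaled-cancel-≤ scaled-0 (scaled-sum z∼w) (ℚ.≤-reflexive (sym Σw≡0))) ,
  (λ i → scaled-cancel-≤ (z∼w i) (z∼w Fin.zero) (w≤w₀ i)) ,
  λ S → scaled-mono-≤ scaled-0 (scaled-sumIn z∼w S)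

-- Signs of reals up to double negation.

p≤∣p∣ : ∀ p → p ℚ.≤ ℚ.∣ p ∣
p≤∣p∣ p with ℚ.≤-total 0ℚ p
... | inj₁ 0≤p = ℚ.≤-reflexive (sym (ℚ.0≤p⇒∣p∣≡p 0≤p))
... | inj₂ p≤0 = ℚ.≤-trans p≤0 (ℚ.0≤∣p∣ p)

0<½* : ∀ {ε} → 0ℚ ℚ.< ε → 0ℚ ℚ.< ½ ℚ.* ε
0<½* {ε} 0<ε = subst (ℚ._< ½ ℚ.* ε) (ℚ.*-zeroʳ ½) (ℚ.*-monoʳ-<-pos ½ 0<ε)

-- By the Cauchy property, one late value below -ε keeps the whole tail below -ε/2. If no such
-- negative bound holds, all late values are at least -ε, which is nonnegativity.
¬¬-sign : ∀ r → ¬ ¬ (0ℝ ≤ℝ r ⊎ ∃[ ε ] 0ℚ ℚ.< ε × Eventually λ m → seq r m ℚ.< ℚ.- ε)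
¬¬-sign r ¬sign = ¬sign (inj₁ nonneg)
  where
  below : ∀ {p q} ε → ℚ.∣ p ℚ.- q ∣ ℚ.< ½ ℚ.* ε → q ℚ.+ ε ℚ.< 0ℚ → p ℚ.< ℚ.- (½ ℚ.* ε)
  below {p} {q} ε p-q< q+ε<0 = begin-strict
    p                                        ≡⟨ split p q ε ⟩
    (p ℚ.- q) ℚ.+ ((q ℚ.+ ε) ℚ.- ε)          ≤⟨ ℚ.+-monoˡ-≤ _ (p≤∣p∣ (p ℚ.- q)) ⟩
    ℚ.∣ p ℚ.- q ∣ ℚ.+ ((q ℚ.+ ε) ℚ.- ε)      <⟨ ℚ.+-mono-< p-q< (ℚ.+-monoˡ-< (ℚ.- ε) q+ε<0) ⟩
    ½ ℚ.* ε ℚ.+ (0ℚ ℚ.- ε)                   ≡⟨ halve ε ⟩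
    ℚ.- (½ ℚ.* ε)                            ∎
    where
    open ℚ.≤-Reasoning
    open +-*-Solver
    split : ∀ p q ε → p ≡ (p ℚ.- q) ℚ.+ ((q ℚ.+ ε) ℚ.- ε)
    split = solve 3 (λ p q ε → p := (p :- q) :+ ((q :+ ε) :- ε)) ≡.refl
    halve : ∀ ε → ½ ℚ.* ε ℚ.+ (0ℚ ℚ.- ε) ≡ ℚ.- (½ ℚ.* ε)
    halve = solve 1 (λ ε → con ½ :* ε :+ (con 0ℚ :- ε) := :- (con ½ :* ε)) ≡.refl

  nonneg : 0ℝ ≤ℝ r
  nonneg ε 0<ε with cauchy r (½ ℚ.* ε) (0<½* 0<ε)
  ... | N , close = N , λ n N≤n → ℚ.≮⇒≥ λ neg →
    ¬sign (inj₂ (½ ℚ.* ε , 0<½* 0<ε , N , λ m N≤m → below ε (close m n N≤m N≤n) neg))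

Eventually-∀Fin : ∀ {n} {P : Fin n → ℕ → Set} → (∀ i → Eventually (P i)) → Eventually λ m → ∀ i → P i m
Eventually-∀Fin {zero}  _ = 0 , λ _ _ ()
Eventually-∀Fin {suc n} p with p Fin.zero | Eventually-∀Fin (p ∘ Fin.suc)
... | M , q | N , r = M ℕ.⊔ N , λ m M⊔N≤m → λ where
  Fin.zero    → q m (ℕ.m⊔n≤o⇒m≤o M N M⊔N≤m)
  (Fin.suc i) → r m (ℕ.m⊔n≤o⇒n≤o M N M⊔N≤m) i

Eventually-∀Subset : ∀ {n} {P : Subset n → ℕ → Set} → (∀ S → Eventually (P S)) → Eventually λ m → ∀ S → P S m
Eventually-∀Subset {zero} p with p []
... | N , q = N , λ { m N≤m [] → q m N≤m }
Eventually-∀Subset {suc n} p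
  with Eventually-∀Subset (p ∘ (inside ∷_)) | Eventually-∀Subset (p ∘ (outside ∷_))
... | M , q | N , r = M ℕ.⊔ N , λ m M⊔N≤m → λ where
  (inside  ∷ S) → q m (ℕ.m⊔n≤o⇒m≤o M N M⊔N≤m) S
  (outside ∷ S) → r m (ℕ.m⊔n≤o⇒n≤o M N M⊔N≤m) S

-- Double negation commutes with quantification over a finite set, and the minimum of finitely many
-- positive bounds serves all subsets because `P` passes to smaller bounds.
¬¬-uniform : ∀ {n} (P : Subset n → ℚ → Set) → (∀ S {ε δ} → δ ℚ.≤ ε → P S ε → P S δ) →
  (∀ S → ¬ ¬ (∃[ ε ] 0ℚ ℚ.< ε × P S ε)) → ¬ ¬ (∃[ ε ] 0ℚ ℚ.< ε × ∀ S → P S ε)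
¬¬-uniform {zero} P anti p ¬u = p [] λ { (ε , 0<ε , q) → ¬u (ε , 0<ε , λ { [] → q }) }
¬¬-uniform {suc n} P anti p ¬u =
  ¬¬-uniform (P ∘ (inside ∷_)) (λ S → anti (inside ∷ S)) (p ∘ (inside ∷_)) λ { (ε , 0<ε , q) →
  ¬¬-uniform (P ∘ (outside ∷_)) (λ S → anti (outside ∷ S)) (p ∘ (outside ∷_)) λ { (δ , 0<δ , r) →
  ¬u (ε ℚ.⊓ δ , ⊓-pos 0<ε 0<δ , λ where
    (inside  ∷ S) → anti (inside ∷ S) (ℚ.p⊓q≤p ε δ) (q S)
    (outside ∷ S) → anti (outside ∷ S) (ℚ.p⊓q≤q ε δ) (r S)) } }
  where
  ⊓-pos : ∀ {ε δ} → 0ℚ ℚ.< ε → 0ℚ ℚ.< δ → 0ℚ ℚ.< ε ℚ.⊓ δ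
  ⊓-pos {ε} {δ} 0<ε 0<δ with ℚ.⊓-sel ε δ
  ... | inj₁ eq = subst (0ℚ ℚ.<_) (sym eq) 0<ε
  ... | inj₂ eq = subst (0ℚ ℚ.<_) (sym eq) 0<δ

seq-sumℝ : ∀ {n} (x : Vector ℝ n) m → seq (sumℝ x) m ≡ sumℚ λ i → seq (x i) m
seq-sumℝ {zero}  x m = ≡.refl
seq-sumℝ {suc n} x m = cong (seq (x Fin.zero) m ℚ.+_) (seq-sumℝ (x ∘ Fin.suc) m)

seq-sumOver : ∀ {n} (x : Vector ℝ n) S m → seq (sumOver x S) m ≡ sumInℚ (λ i → seq (x i) m) S
seq-sumOver x []            m = ≡.refl
seq-sumOver x (inside  ∷ S) m = cong (seq (x Fin.zero) m ℚ.+_) (seq-sumOver (x ∘ Fin.suc) S m)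
seq-sumOver x (outside ∷ S) m = cong (0ℚ ℚ.+_) (seq-sumOver (x ∘ Fin.suc) S m)

-- Rational and integer approximations with total zero.

-- Raising the first entry by ε makes it maximal; lowering the second one by
-- ε + Σ q then makes the total zero, and no subset sum grows by more than ε.
module Correction {n} (q : Vector ℚ (2 ℕ.+ n)) {ε} (0<ε : 0ℚ ℚ.< ε) (∣Σq∣<ε : ℚ.∣ sumℚ q ∣ ℚ.< ε)
                  (q≤q₀+ε : ∀ i → q i ℚ.≤ q Fin.zero ℚ.+ ε) where

  open ℚ.≤-Reasoning
  open +-*-Solver

  q₀ = q Fin.zero
  q₁ = q (Fin.suc Fin.zero)
  δ = ε ℚ.+ sumℚ q

  w : Vector ℚ (2 ℕ.+ n)
  w Fin.zero                = q₀ ℚ.+ ε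
  w (Fin.suc Fin.zero)      = q₁ ℚ.- δ
  w i@(Fin.suc (Fin.suc _)) = q i

  rest : Vector ℚ n
  rest i = q (Fin.suc (Fin.suc i))

  p≤p+t : ∀ p {t} → 0ℚ ℚ.≤ t → p ℚ.≤ p ℚ.+ t
  p≤p+t p {t} 0≤t = begin
    p           ≡⟨ ℚ.+-identityʳ p ⟨
    p ℚ.+ 0ℚ    ≤⟨ ℚ.+-monoʳ-≤ p 0≤t ⟩
    p ℚ.+ t     ∎

  0≤ε : 0ℚ ℚ.≤ ε
  0≤ε = ℚ.<⇒≤ 0<ε

  0≤δ : 0ℚ ℚ.≤ δ
  0≤δ = begin
    0ℚ                              ≡⟨ ℚ.+-inverseˡ σ ⟨
    ℚ.- σ ℚ.+ σ                     ≤⟨ ℚ.+-monoˡ-≤ σ (p≤∣p∣ (ℚ.- σ)) ⟩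
    ℚ.∣ ℚ.- σ ∣ ℚ.+ σ               ≡⟨ cong (ℚ._+ σ) (ℚ.∣-p∣≡∣p∣ σ) ⟩
    ℚ.∣ σ ∣ ℚ.+ σ                   ≤⟨ ℚ.+-monoˡ-≤ σ (ℚ.<⇒≤ ∣Σq∣<ε) ⟩
    ε ℚ.+ σ                         ∎
    where σ = sumℚ q

  Σw≡0 : sumℚ w ≡ 0ℚ
  Σw≡0 = cancel q₀ q₁ (sumℚ rest) ε
    where
    cancel : ∀ a b r e → (a ℚ.+ e) ℚ.+ ((b ℚ.- (e ℚ.+ (a ℚ.+ (b ℚ.+ r)))) ℚ.+ r) ≡ 0ℚ
    cancel = solve 4 (λ a b r e → (a :+ e) :+ ((b :- (e :+ (a :+ (b :+ r)))) :+ r) := con 0ℚ) ≡.refl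

  w≤w₀ : ∀ i → w i ℚ.≤ w Fin.zero
  w≤w₀ Fin.zero                = ℚ.≤-refl
  w≤w₀ (Fin.suc Fin.zero)      = begin
    q₁ ℚ.- δ             ≤⟨ p≤p+t (q₁ ℚ.- δ) 0≤δ ⟩
    (q₁ ℚ.- δ) ℚ.+ δ     ≡⟨ cancel q₁ δ ⟩
    q₁                   ≤⟨ q≤q₀+ε (Fin.suc Fin.zero) ⟩
    q₀ ℚ.+ ε             ∎
    where
    cancel : ∀ p t → (p ℚ.- t) ℚ.+ t ≡ p
    cancel = solve 2 (λ p t → (p :- t) :+ t := p) ≡.refl
  w≤w₀ i@(Fin.suc (Fin.suc _)) = q≤q₀+ε i

  sumIn-w≤ : ∀ S → sumInℚ w S ℚ.≤ sumInℚ q S ℚ.+ ε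
  sumIn-w≤ (b₀ ∷ b₁ ∷ S) = bound b₀ b₁ (sumInℚ rest S)
    where
    in-in : ∀ a b r e d → ((a ℚ.+ e) ℚ.+ ((b ℚ.- d) ℚ.+ r)) ℚ.+ d ≡ (a ℚ.+ (b ℚ.+ r)) ℚ.+ e
    in-in = solve 5 (λ a b r e d → ((a :+ e) :+ ((b :- d) :+ r)) :+ d := (a :+ (b :+ r)) :+ e) ≡.refl
    in-out : ∀ a r e → (a ℚ.+ e) ℚ.+ r ≡ (a ℚ.+ r) ℚ.+ e
    in-out = solve 3 (λ a r e → (a :+ e) :+ r := (a :+ r) :+ e) ≡.refl
    out-in : ∀ z b r e d → (z ℚ.+ ((b ℚ.- d) ℚ.+ r)) ℚ.+ (d ℚ.+ e) ≡ (z ℚ.+ (b ℚ.+ r)) ℚ.+ e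
    out-in = solve 5 (λ z b r e d → (z :+ ((b :- d) :+ r)) :+ (d :+ e) := (z :+ (b :+ r)) :+ e) ≡.refl
    bound : ∀ b₀ b₁ r →
      (if b₀ then q₀ ℚ.+ ε else 0ℚ) ℚ.+ ((if b₁ then q₁ ℚ.- δ else 0ℚ) ℚ.+ r) ℚ.≤
      ((if b₀ then q₀ else 0ℚ) ℚ.+ ((if b₁ then q₁ else 0ℚ) ℚ.+ r)) ℚ.+ ε
    -- The slack in the four cases is `δ`, 0, `δ + ε` and `ε`, depending on which of the two altered
    -- entries are taken.
    bound true  true  r = subst (((q₀ ℚ.+ ε) ℚ.+ ((q₁ ℚ.- δ) ℚ.+ r)) ℚ.≤_) (in-in q₀ q₁ r ε δ) (p≤p+t _ 0≤δ)
    bound true  false r = ℚ.≤-reflexive (in-out q₀ (0ℚ ℚ.+ r) ε)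
    bound false true  r = subst ((0ℚ ℚ.+ ((q₁ ℚ.- δ) ℚ.+ r)) ℚ.≤_) (out-in 0ℚ q₁ r ε δ) (p≤p+t _ (ℚ.+-mono-≤ 0≤δ 0≤ε))
    bound false false r = p≤p+t _ 0≤ε

-- The last condition is one-sided: up to double negation, the nonnegative sets of `z` lie among
-- those of `x`. The double negation appears because the condition is proved by contraposition.
IntegerApproximation : ∀ {n} → Vector ℝ (suc n) → Set
IntegerApproximation x = ∃[ z ] sumℤ z ≡ 0ℤ × (∀ i → z i ℤ.≤ z Fin.zero) ×
  (∀ S → 0ℤ ℤ.≤ sumInℤ z S → ¬ ¬ (0ℝ ≤ℝ sumOver x S))

-- At index `m` every sum that is not nonnegative lies below -ε, and the correction raises it by at
-- most ε, so it stays negative.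
approximation-at : ∀ {n} (x : Vector ℝ (2 ℕ.+ n)) m {ε} → 0ℚ ℚ.< ε →
  ℚ.∣ seq (sumℝ x) m ℚ.- 0ℚ ∣ ℚ.< ε →
  (∀ i → seq (x i) m ℚ.≤ seq (x Fin.zero) m ℚ.+ ε) →
  (∀ S → ¬ (0ℝ ≤ℝ sumOver x S) → seq (sumOver x S) m ℚ.< ℚ.- ε) →
  IntegerApproximation x
approximation-at {n} x m {ε} 0<ε ∣Σ∣<ε q≤q₀+ε negative =
  let z , Σz≡0 , z≤z₀ , z-sound = clear-denominators w Σw≡0 w≤w₀
  in z , Σz≡0 , z≤z₀ , λ S 0≤zS ¬nonneg →
       ℚ.<-irrefl ≡.refl (ℚ.<-≤-trans (wS<0 S ¬nonneg) (z-sound S 0≤zS))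
  where
  q : Vector ℚ (2 ℕ.+ n)
  q i = seq (x i) m
  Σq-0≡ : seq (sumℝ x) m ℚ.- 0ℚ ≡ sumℚ q
  Σq-0≡ = ≡.trans (ℚ.+-identityʳ (seq (sumℝ x) m)) (seq-sumℝ x m)
  open Correction q 0<ε (subst (λ p → ℚ.∣ p ∣ ℚ.< ε) Σq-0≡ ∣Σ∣<ε) q≤q₀+ε
    using (w; Σw≡0; w≤w₀; sumIn-w≤)
  wS<0 : ∀ S → ¬ (0ℝ ≤ℝ sumOver x S) → sumInℚ w S ℚ.< 0ℚ
  wS<0 S ¬nonneg = begin-strict
    sumInℚ w S                    ≤⟨ sumIn-w≤ S ⟩
    sumInℚ q S ℚ.+ ε              ≡⟨ cong (ℚ._+ ε) (seq-sumOver x S m) ⟨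
    seq (sumOver x S) m ℚ.+ ε     <⟨ ℚ.+-monoˡ-< ε (negative S ¬nonneg) ⟩
    ℚ.- ε ℚ.+ ε                   ≡⟨ ℚ.+-inverseˡ ε ⟩
    0ℚ                            ∎
    where open ℚ.≤-Reasoning

-- First one ε is found that separates all negative subset sums from 0, then one index beyond every
-- threshold belonging to that ε.
¬¬-approximation : ∀ {n} (x : Vector ℝ (2 ℕ.+ n)) → sumℝ x ≃ℝ 0ℝ → (∀ i → x i ≤ℝ x Fin.zero) →
  ¬ ¬ IntegerApproximation x
¬¬-approximation {n} x Σx≃0 x≤x₀ ¬approx = ¬¬-uniform (λ S ε → Eventually (Negative S ε)) anti negative approx
  where
  Negative : Subset (2 ℕ.+ n) → ℚ → ℕ → Set
  Negative S ε m = ¬ (0ℝ ≤ℝ sumOver x S) → seq (sumOver x S) m ℚ.< ℚ.- ε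

  anti : ∀ S {ε δ} → δ ℚ.≤ ε → Eventually (Negative S ε) → Eventually (Negative S δ)
  anti S δ≤ε (N , p) = N , λ m N≤m ¬nonneg → ℚ.<-≤-trans (p m N≤m ¬nonneg) (ℚ.neg-antimono-≤ δ≤ε)

  negative : ∀ S → ¬ ¬ (∃[ ε ] 0ℚ ℚ.< ε × Eventually (Negative S ε))
  negative S ¬neg = ¬¬-sign (sumOver x S) λ where
    -- For a nonnegative sum the condition is vacuous, so any positive number serves.
    (inj₁ nonneg)            → ¬neg (½ , ℚ.positive⁻¹ ½ , 0 , λ _ _ ¬nonneg → contradiction nonneg ¬nonneg)
    (inj₂ (ε , 0<ε , N , p)) → ¬neg (ε , 0<ε , N , λ m N≤m _ → p m N≤m)

  approx : ¬ (∃[ ε ] 0ℚ ℚ.< ε × ∀ S → Eventually (Negative S ε))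
  approx (ε , 0<ε , neg) = combine (Eventually-∀Subset {P = λ S → Negative S ε} neg)
    (Eventually-∀Fin {P = λ i m → seq (x i) m ℚ.≤ seq (x Fin.zero) m ℚ.+ ε} λ i → x≤x₀ i ε 0<ε)
    (Σx≃0 ε 0<ε)
    where
    combine : Eventually (λ m → ∀ S → Negative S ε m) →
      Eventually (λ m → ∀ i → seq (x i) m ℚ.≤ seq (x Fin.zero) m ℚ.+ ε) →
      Eventually (λ m → ℚ.∣ seq (sumℝ x) m ℚ.- 0ℚ ∣ ℚ.< ε) → ⊥
    combine (N₁ , p₁) (N₂ , p₂) (N₃ , p₃) = ¬approx (approximation-at x (N₁ ℕ.⊔ (N₂ ℕ.⊔ N₃)) 0<ε
      (p₃ _ (ℕ.≤-trans (ℕ.m≤n⊔m N₂ N₃) (ℕ.m≤n⊔m N₁ (N₂ ℕ.⊔ N₃))))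
      (p₂ _ (ℕ.≤-trans (ℕ.m≤m⊔n N₂ N₃) (ℕ.m≤n⊔m N₁ (N₂ ℕ.⊔ N₃))))
      (p₁ _ (ℕ.m≤m⊔n N₁ (N₂ ℕ.⊔ N₃))))

-- Comparing the given family with the star.

outside≢inside∷ : ∀ {n} (S : Subset n) {Ss T} → T List.∈ map (inside ∷_) Ss → ¬ (outside ∷ S ≡ T)
outside≢inside∷ S p ≡.refl with _ , _ , () ← ∈-map⁻ (inside ∷_) p

module _ {n j c : ℕ} (x : Vector ℝ (suc n)) (card : HasCardinality (NonnegativeSubset (suc j) x) c) where

  private
    F = NonnegativeSubset (suc j) x
    F-list = proj₁ card
    open DecMembership (≡-dec {n = suc n} Bool._≟_) using (_∈?_)

    module F⇔ S = Equivalence (proj₁ (proj₂ (proj₂ card)) S)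

    |F|≡c : length F-list ≡ c
    |F|≡c = proj₂ (proj₂ (proj₂ card))

    -- Membership in the enumerating list is decidable, since its elements are Boolean vectors, and
    -- it is equivalent to membership in the family.
    F-stable : ∀ {S} → ¬ ¬ F S → F S
    F-stable {S} ¬¬FS = F⇔.to S (decidable-stable (S ∈? F-list) λ ∉F → ¬¬FS (∉F ∘ F⇔.from S))

    length≤c : ∀ {xs} → Unique xs → (∀ {S} → S List.∈ xs → F S) → length xs ℕ.≤ c
    length≤c xs! xs⊆F = subst (_ ℕ.≤_) |F|≡c (length-mono-⊆ xs! λ {S} S∈xs → F⇔.from S (xs⊆F S∈xs))

    star : List (Subset (suc n))
    star = map (inside ∷_) (ksubsets n j)

    |star|≡ : length star ≡ n C j
    |star|≡ = ≡.trans (length-map _ (ksubsets n j)) (length-ksubsets n j)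

    star! : Unique star
    star! = Unique.map⁺ ∷-injectiveʳ (ksubsets-unique n j)

  Conclusion : Set
  Conclusion = c ℕ.≥ n C j × (c ≡ n C j → F ≐ Star (suc j) Fin.zero)

  -- The inequality and the membership of the first index in a set are decidable, and `F` is stable
  -- through its enumeration.
  conclusion-stable : ¬ ¬ Conclusion → Conclusion
  conclusion-stable ¬¬p =
    decidable-stable ((n C j) ℕ.≤? c) (λ ¬c≥ → ¬¬p (¬c≥ ∘ proj₁)) ,
    λ c≡ →
      (λ {S} FS → proj₁ FS , decidable-stable (Fin.zero Subset.∈? S) λ ∉S → ¬¬p λ p → ∉S (proj₂ (proj₁ (proj₂ p c≡) FS))) ,
      λ {S} S∈★ → F-stable {S} λ ¬FS → ¬¬p λ p → ¬FS (proj₂ (proj₂ p c≡) S∈★)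

  conclusion-if-star⊆F : (∀ S → ∣ S ∣ ≡ j → F (inside ∷ S)) → Conclusion
  conclusion-if-star⊆F star⊆F = subst (ℕ._≤ c) |star|≡ (length≤c star! star-list⊆F) , λ c≡ → F⊆Star c≡ , Star⊆F
    where
    star-list⊆F : ∀ {S} → S List.∈ star → F S
    star-list⊆F = All.lookup {P = F} (All.map⁺ (All.tabulate λ {S} S∈ → star⊆F S (∈-ksubsets⁻ n j S∈)))

    Star⊆F : ∀ {S} → Star (suc j) Fin.zero S → F S
    Star⊆F {inside ∷ S} (|S|≡ , here) = star⊆F S (ℕ.suc-injective |S|≡)

    F⊆Star : c ≡ n C j → ∀ {S} → F S → Star (suc j) Fin.zero S
    F⊆Star c≡ {inside  ∷ S} FS = proj₁ FS , here
    -- A member outside the star, added to the whole star, would give `n C j` + 1 members.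
    F⊆Star c≡ {outside ∷ S} FS = contradiction
      (length≤c {(outside ∷ S) ∷ star} (All.tabulate (outside≢inside∷ S) ∷ star!)
        (All.lookup (FS ∷ All.tabulate star-list⊆F)))
      (ℕ.<⇒≱ (s≤s (ℕ.≤-reflexive (≡.trans c≡ (sym |star|≡)))))

  -- A strict surplus excludes equality, so the second half holds vacuously.
  conclusion-if-many : ∀ {xs} → Unique xs → (∀ {S} → S List.∈ xs → F S) → n C j ℕ.< length xs → Conclusion
  conclusion-if-many xs! xs⊆F many = ℕ.<⇒≤ B<c , λ c≡ → contradiction (sym c≡) (ℕ.<⇒≢ B<c)
    where
    B<c : n C j ℕ.< c
    B<c = ℕ.<-≤-trans many (length≤c xs! xs⊆F)

  conclusion-from-approximation : 8 ℕ.* (suc j ℕ.* suc j) ℕ.≤ suc n → IntegerApproximation x → Conclusion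
  conclusion-from-approximation large (z , Σz≡0 , z≤z₀ , z-sound) =
    [ (λ star-nonneg → conclusion-if-star⊆F λ S |S|≡j → inF (inside ∷ S) (cong suc |S|≡j) (star-nonneg S |S|≡j))
    , conclusion-if-many (Unique.filter⁺ 0≤z? (ksubsets-unique (suc n) (suc j))) sound
    ]′ (star-or-many n j z Σz≡0 z≤z₀ large)
    where
    0≤z? : ∀ S → Dec (0ℤ ℤ.≤ sumInℤ z S)
    0≤z? S = 0ℤ ℤ.≤? sumInℤ z S

    inF : ∀ S → ∣ S ∣ ≡ suc j → 0ℤ ℤ.≤ sumInℤ z S → F S
    inF S |S|≡k 0≤zS = F-stable {S} λ ¬FS → z-sound S 0≤zS λ nonneg → ¬FS (|S|≡k , nonneg)

    sound : ∀ {S} → S List.∈ filter 0≤z? (ksubsets (suc n) (suc j)) → F S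
    sound {S} p = let S∈ , 0≤zS = ∈-filter⁻ 0≤z? p in inF S (∈-ksubsets⁻ (suc n) (suc j) S∈) 0≤zS

-- Passage from real numbers to an integer approximation.

open import Data.Nat.Base using (NonZero; pred; _*_; _^_; _≤_; _≥_)

theorem1p2 : (n k : ℕ) .{{_ : NonZero n}} .{{_ : NonZero k}} (x : Vector ℝ n) →
  sumℝ x ≃ℝ 0ℝ →
  (∀ (i j : Fin n) → i Fin.≤ j → x j ≤ℝ x i) →
  n ≥ 8 * k ^ 2 →
  ∀ (c : ℕ) → HasCardinality (NonnegativeSubset k x) c →
    c ≥ pred n C pred k ×
    (c ≡ pred n C pred k → NonnegativeSubset k x ≐ Star k (firstIndex n))
theorem1p2 n (suc j) x Σx≃0 sorted large c card = go n x Σx≃0 sorted card large (ℕ.≤-trans (ℕ.m≤m*n 8 (suc j ^ 2)) large)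
  where
  -- The bound 8 ≤ n excludes n = 1: the correction alters two distinct entries.
  go : ∀ n .{{_ : NonZero n}} (x : Vector ℝ n) → sumℝ x ≃ℝ 0ℝ → (∀ (i j : Fin n) → i Fin.≤ j → x j ≤ℝ x i) →
    HasCardinality (NonnegativeSubset (suc j) x) c → 8 * suc j ^ 2 ℕ.≤ n → 8 ℕ.≤ n →
    c ≥ pred n C j × (c ≡ pred n C j → NonnegativeSubset (suc j) x ≐ Star (suc j) (firstIndex n))
  -- Stability of the conclusion allows the merely doubly negated approximation to be used as if it
  -- were given.
  go (suc (suc n)) x Σx≃0 sorted card large _ = conclusion-stable x card λ ¬p →
    ¬¬-approximation x Σx≃0 (λ i → sorted Fin.zero i z≤n)
      (¬p ∘ conclusion-from-approximation x card
        (subst (λ k² → 8 ℕ.* k² ℕ.≤ 2 ℕ.+ n) (cong (suc j ℕ.*_) (ℕ.*-identityʳ (suc j))) large))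
  go (suc zero) _ _ _ _ _ (s≤s ())
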